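{- Let $m$ and $d$ be positive integers, and let $U_{m,d}$ be the uniform matroid of rank $d$ on a set of $m+d$ elements. Write its Kazhdan–Lusztig polynomial as $P_{U_{m,d}}(t)=\sum_{i=0}^{\lfloor (d-1)/2\rfloor} c_{m,d}^i t^i$. Then for every $0\le i\le \lfloor (d-1)/2\rfloor$, \[ c_{m,d}^i=\frac{1}{d-i}\binom{d+m}{i}\sum_{h=0}^{m-1}\binom{d-i+h}{h+i+1}\binom{i-1+h}{h}. \]
   Context: Binomial coefficients are $\binom{x}{h}=x(x-1)\cdots(x-h+1)/h!$ for integers $h\ge 0$ (so $\binom{ -1}{0}=1$, and $\binom{h-1}{h}=0$ for $h\ge1$). For a loopless matroid $M$ with lattice of flats $L(M)$, characteristic polynomial $\chi_M(t)$ and rank $\operatorname{rk} M$, the Kazhdan–Lusztig polynomial $P_M(t)\in\mathbb{Z}[t]$ is the unique assignment such that: $P_M(t)=1$ if $\operatorname{rk}M=0$; $\deg P_M(t)<\frac12\operatorname{rk}M$ if $\operatorname{rk}M>0$; and $t^{\operatorname{rk}M}P_M(t^{ -1})=\sum_{F\in L(M)}\chi_{M_F}(t)P_{M^F}(t)$, where $M_F$ is the restriction of $M$ to the flat $F$ and $M^F$ is the contraction of $M$ by $F$. -}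

module Defs where

open import Data.Bool using (Bool; true; false; if_then_else_; _∧_; not)
open import Data.Nat as ℕ using (ℕ; zero; suc; _≤_; _≡ᵇ_; _≤ᵇ_; _⊓_; _∸_)
open import Data.Nat.Combinatorics using (_C_)
open import Data.Integer as ℤ using (ℤ; +_; -[1+_])
open import Data.Fin using (Fin)
open import Data.Fin.Subset using (Subset; inside; outside; ⊤; ⁅_⁆; _∪_; _∩_; ∁; ∣_∣; _⊆_; _∈_)
open import Data.List using (List; []; _∷_; map; _++_; foldr; filter; upTo)
open import Data.List as L using ()
open import Data.Vec using (Vec; []; _∷_; lookup)
open import Data.Product using (_×_)
open import Relation.Binary.PropositionalEquality using (_≡_)

sumℤ : List ℤ → ℤ
sumℤ = foldr ℤ._+_ (+ 0)

subsets : (n : ℕ) → List (Subset n)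
subsets zero    = [] ∷ []
subsets (suc n) = map (outside ∷_) (subsets n) ++ map (inside ∷_) (subsets n)

_⊆ᵇ_ : {n : ℕ} → Subset n → Subset n → Bool
[]            ⊆ᵇ []       = true
(true  ∷ xs)  ⊆ᵇ (y ∷ ys) = y ∧ (xs ⊆ᵇ ys)
(false ∷ xs)  ⊆ᵇ (y ∷ ys) = xs ⊆ᵇ ys

allFin : (n : ℕ) → List (Fin n)
allFin n = Data.List.allFin n
  where import Data.List

allᵇ : {A : Set} → (A → Bool) → List A → Bool
allᵇ p = foldr (λ x b → p x ∧ b) true

-- Polynomials with integer coefficients, as coefficient sequences
-- (coefficient of t^i is  p i).

Poly : Set
Poly = ℕ → ℤ

_*P_ : Poly → Poly → Poly
(p *P q) k = sumℤ (map (λ j → p j ℤ.* q (k ∸ j)) (upTo (suc k)))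

-- t^r p(t⁻¹)  (meaningful for deg p ≤ r)
reflect : ℕ → Poly → Poly
reflect r p i = if i ≤ᵇ r then p (r ∸ i) else + 0

oneP : Poly
oneP zero    = + 1
oneP (suc _) = + 0

-- Matroid data on a ground set E ⊆ Fin n, given by a rank function.
-- (Keeping the ambient Fin n fixed lets restrictions and contractions
--  be expressed without re-indexing the ground set.)

record MData (n : ℕ) : Set where
  field
    ground : Subset n
    rk     : Subset n → ℕ
open MData public

record IsLooplessMatroid {n : ℕ} (M : MData n) : Set where
  field
    rk-≤card   : ∀ S → S ⊆ ground M → rk M S ≤ ∣ S ∣
    rk-mono    : ∀ S T → S ⊆ T → T ⊆ ground M → rk M S ≤ rk M T
    rk-submod  : ∀ S T → S ⊆ ground M → T ⊆ ground M →
                 rk M (S ∪ T) ℕ.+ rk M (S ∩ T) ≤ rk M S ℕ.+ rk M T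
    loopless   : ∀ e → e ∈ ground M → rk M ⁅ e ⁆ ≡ 1

rank : {n : ℕ} → MData n → ℕ
rank M = rk M (ground M)

isFlat : {n : ℕ} → MData n → Subset n → Bool
isFlat {n} M F =
  (F ⊆ᵇ ground M) ∧
  allᵇ (λ e → if lookup (ground M) e ∧ not (lookup F e)
               then not (rk M (F ∪ ⁅ e ⁆) ≡ᵇ rk M F)
               else true)
       (allFin n)

restrict : {n : ℕ} → MData n → Subset n → MData n
restrict M F = record { ground = F ; rk = rk M }

contract : {n : ℕ} → MData n → Subset n → MData n
contract M F = record { ground = ground M ∩ ∁ F ; rk = λ S → rk M (S ∪ F) ∸ rk M F }

sgn : ℕ → ℤ
sgn zero          = + 1
sgn (suc zero)    = -[1+ 0 ]
sgn (suc (suc k)) = sgn k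

charPoly : {n : ℕ} → MData n → Poly
charPoly {n} M k =
  sumℤ (map (λ S → if (S ⊆ᵇ ground M) ∧ ((rank M ∸ rk M S) ≡ᵇ k)
                    then sgn ∣ S ∣ else + 0)
            (subsets n))

KLsum : ({n : ℕ} → MData n → Poly) → {n : ℕ} → MData n → Poly
KLsum P {n} M i =
  sumℤ (map (λ F → if isFlat M F then (charPoly (restrict M F) *P P (contract M F)) i else + 0)
            (subsets n))

IsKL : ({n : ℕ} → MData n → Poly) → Set
IsKL P = ∀ {n} (M : MData n) → IsLooplessMatroid M →
  (rank M ≡ 0 → ∀ i → P M i ≡ oneP i) ×
  (0 ℕ.< rank M → ∀ i → rank M ≤ 2 ℕ.* i → P M i ≡ + 0) ×
  (∀ i → reflect (rank M) (P M) i ≡ KLsum P M i)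

U : (m d : ℕ) → MData (m ℕ.+ d)
U m d = record { ground = ⊤ ; rk = λ S → ∣ S ∣ ⊓ d }

-- binomial coefficient with integer top x and natural bottom h:
-- x(x-1)…(x-h+1)/h!.  For x = -(k+1) this equals (-1)^h C(k+h, h).
binomℤ : ℤ → ℕ → ℤ
binomℤ (+ n)     h = + (n C h)
binomℤ -[1+ k ]  h = sgn h ℤ.* + ((k ℕ.+ h) C h)

Σ< : ℕ → (ℕ → ℤ) → ℤ
Σ< m f = sumℤ (map f (upTo m))

{-# OPTIONS --safe #-}
-- Write m = μ + 1 and q_d for the Kazhdan–Lusztig polynomial of the uniform matroid of rank d on m + d
-- elements.  The flats are the sets with fewer than d elements and the ground set, and contracting by a
-- proper flat changes d but not m, so for fixed m the definition is a recursion in d: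
--   t^d q_d(1/t) = χ_{U_{m,d}}(t) + Σ_{j<d} C(m+d,j) (t-1)^j q_{d-j}(t).
-- The binomial transform s_d = Σ_k (-1)^k C(m+d,k) q_{d-k} turns the right-hand sum into
-- Σ_k C(m+d,k) t^k s_{d-k}; inverting this along a diagonal and using deg q_d < d/2 gives, for 2i < d,
--   [t^i] s_d = (-1)^d (C(m+d,i) C(m+d-i-1,d-i) - C(m+d,d-i) C(m+i-1,i)),
-- and [t^i] s_d = 0 otherwise.  Inverting the transform expresses [t^i] q_d as an alternating sum.  With
-- D = d - i fixed, both this sum (times D / C(d+m,i)) and the sum over h in the claim vanish at i = D, and
-- in both cases the values at i and i + 1 add up to C(D+m,m+i+1) C(m+i-1,i): on the first side by
-- absorption, on the second because the summands telescope in h.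
module Submission where

open import Defs
open import Data.Nat using (ℕ; _≤_; _∸_; _+_; _*_)
open import Data.Nat.Combinatorics using (_C_)
open import Data.Integer using (ℤ; +_; _-_) renaming (_*_ to _*ℤ_; _+_ to _+ℤ_)
open import Relation.Binary.PropositionalEquality using (_≡_)

open import Data.Bool using (Bool; true; false; if_then_else_; _∧_; not)
open import Data.Bool.Properties using (if-∧; T-≡)
open import Data.Empty using (⊥-elim)
open import Data.Fin using (Fin)
open import Data.Fin.Subset using (Subset; inside; outside; ⊥; ⁅_⁆; _∪_; _∩_; ∁; _⊆_; _∈_; _∉_) renaming (∣_∣ to size)
import Data.Fin.Subset.Properties as SP
open import Data.Integer using (-_)
import Data.Integer.Properties as ℤP
open import Data.Integer.Tactic.RingSolver using (solve-∀)
open import Data.List using (List; []; _∷_; map; _++_)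
open import Data.List.Properties using (map-++; map-∘; map-cong; map-upTo)
import Data.List.Membership.Propositional as List
open import Data.List.Membership.Propositional.Properties using (∈-allFin)
open import Data.List.Relation.Unary.Any using (here; there)
open import Data.Nat using (zero; suc; _<_; _≡ᵇ_; _<ᵇ_; _⊓_; s≤s; z≤n)
open import Data.Nat.Combinatorics using (nCn≡1; nCk≡nC[n∸k]; nCk+nC[k+1]≡[n+1]C[k+1])
open import Data.Nat.Combinatorics.Specification using (k>n⇒nCk≡0)
open import Data.Nat.Induction using (<-rec)
import Data.Nat.Properties as ℕP
import Data.Nat.Tactic.RingSolver as ℕSolver
open import Data.Product using (_×_; _,_; proj₁; proj₂; ∃)
open import Data.Sum using (inj₁; inj₂; [_,_]′)
open import Data.Vec using ([]; _∷_; lookup)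
open import Data.Vec.Properties using (lookup⇒[]=; []=⇒lookup)
open import Function using (_∘_; Equivalence)
open import Relation.Binary.PropositionalEquality using (refl; sym; trans; cong; cong₂; subst; module ≡-Reasoning)
import Algebra.Properties.AbelianGroup ℤP.+-0-abelianGroup as ℤG

open ≡-Reasoning

-- Antidiagonal sums and binomial coefficients

-- The sum over all pairs with k + l = a. Carrying both indices replaces truncated subtraction, and
-- `conv-cong` still supplies the equation k + l = a to its argument.
conv : ℕ → (ℕ → ℕ → ℤ) → ℤ
conv zero    f = f 0 0
conv (suc a) f = f 0 (suc a) +ℤ conv a (λ k l → f (suc k) l)

conv-cong : ∀ a {f g : ℕ → ℕ → ℤ} → (∀ k l → k + l ≡ a → f k l ≡ g k l) → conv a f ≡ conv a g
conv-cong zero    eq = eq 0 0 refl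
conv-cong (suc a) eq = cong₂ _+ℤ_ (eq 0 (suc a) refl) (conv-cong a (λ k l p → eq (suc k) l (cong suc p)))

conv-0 : ∀ a {f : ℕ → ℕ → ℤ} → (∀ k l → k + l ≡ a → f k l ≡ + 0) → conv a f ≡ + 0
conv-0 zero    eq = eq 0 0 refl
conv-0 (suc a) eq = cong₂ _+ℤ_ (eq 0 (suc a) refl) (conv-0 a (λ k l p → eq (suc k) l (cong suc p)))

conv-last : ∀ a (f : ℕ → ℕ → ℤ) → conv (suc a) f ≡ conv a (λ k l → f k (suc l)) +ℤ f (suc a) 0
conv-last zero    f = refl
conv-last (suc a) f = begin
  f 0 (suc (suc a)) +ℤ conv (suc a) (λ k l → f (suc k) l)
    ≡⟨ cong (f 0 (suc (suc a)) +ℤ_) (conv-last a (λ k l → f (suc k) l)) ⟩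
  f 0 (suc (suc a)) +ℤ (conv a (λ k l → f (suc k) (suc l)) +ℤ f (suc (suc a)) 0)
    ≡⟨ ℤP.+-assoc (f 0 (suc (suc a))) _ _ ⟨
  conv (suc a) (λ k l → f k (suc l)) +ℤ f (suc (suc a)) 0 ∎

conv-comm : ∀ a (f : ℕ → ℕ → ℤ) → conv a f ≡ conv a (λ k l → f l k)
conv-comm zero    f = refl
conv-comm (suc a) f = begin
  conv (suc a) f                                   ≡⟨ conv-last a f ⟩
  conv a (λ k l → f k (suc l)) +ℤ f (suc a) 0      ≡⟨ ℤP.+-comm _ (f (suc a) 0) ⟩
  f (suc a) 0 +ℤ conv a (λ k l → f k (suc l))      ≡⟨ cong (f (suc a) 0 +ℤ_) (conv-comm a _) ⟩
  conv (suc a) (λ k l → f l k) ∎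

+-interchange : ∀ a b c d → (a +ℤ b) +ℤ (c +ℤ d) ≡ (a +ℤ c) +ℤ (b +ℤ d)
+-interchange = solve-∀

conv-+ : ∀ a (f g : ℕ → ℕ → ℤ) → conv a (λ k l → f k l +ℤ g k l) ≡ conv a f +ℤ conv a g
conv-+ zero    f g = refl
conv-+ (suc a) f g = trans
  (cong (f 0 (suc a) +ℤ g 0 (suc a) +ℤ_) (conv-+ a _ _))
  (+-interchange (f 0 (suc a)) (g 0 (suc a)) _ _)

conv-*ˡ : ∀ a c (f : ℕ → ℕ → ℤ) → conv a (λ k l → c *ℤ f k l) ≡ c *ℤ conv a f
conv-*ˡ zero    c f = refl
conv-*ˡ (suc a) c f = trans
  (cong (c *ℤ f 0 (suc a) +ℤ_) (conv-*ˡ a c _))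
  (sym (ℤP.*-distribˡ-+ c (f 0 (suc a)) _))

conv-*ʳ : ∀ a c (f : ℕ → ℕ → ℤ) → conv a (λ k l → f k l *ℤ c) ≡ conv a f *ℤ c
conv-*ʳ a c f = begin
  conv a (λ k l → f k l *ℤ c)  ≡⟨ conv-cong a (λ k l _ → ℤP.*-comm (f k l) c) ⟩
  conv a (λ k l → c *ℤ f k l)  ≡⟨ conv-*ˡ a c f ⟩
  c *ℤ conv a f                ≡⟨ ℤP.*-comm c _ ⟩
  conv a f *ℤ c ∎

conv-swap : ∀ a b (f : ℕ → ℕ → ℕ → ℕ → ℤ) →
  conv a (λ k l → conv b (λ p q → f k l p q)) ≡ conv b (λ p q → conv a (λ k l → f k l p q))
conv-swap zero    b f = refl
conv-swap (suc a) b f = trans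
  (cong (conv b (f 0 (suc a)) +ℤ_) (conv-swap a b (λ k l → f (suc k) l)))
  (sym (conv-+ b (f 0 (suc a)) _))

-- Both sides sum `f` over all triples of indices with total a, grouped differently.
conv-assoc : ∀ a (f : ℕ → ℕ → ℕ → ℤ) →
  conv a (λ k l → conv l (λ p q → f k p q)) ≡ conv a (λ x q → conv x (λ k p → f k p q))
conv-assoc zero    f = refl
conv-assoc (suc a) f = begin
  conv (suc a) (f 0) +ℤ conv a (λ k l → conv l (f (suc k)))
    ≡⟨ cong (conv (suc a) (f 0) +ℤ_) (conv-assoc a (λ k → f (suc k))) ⟩
  (f 0 0 (suc a) +ℤ conv a (λ x q → f 0 (suc x) q)) +ℤ conv a (λ x q → conv x (λ k p → f (suc k) p q))
    ≡⟨ ℤP.+-assoc (f 0 0 (suc a)) _ _ ⟩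
  f 0 0 (suc a) +ℤ (conv a (λ x q → f 0 (suc x) q) +ℤ conv a (λ x q → conv x (λ k p → f (suc k) p q)))
    ≡⟨ cong (f 0 0 (suc a) +ℤ_) (conv-+ a _ _) ⟨
  conv (suc a) (λ x q → conv x (λ k p → f k p q)) ∎

-- A cut at k = a. It separates set sizes up to the rank from larger ones, and ranks above 2i from
-- those up to 2i.
conv-split : ∀ a b (f : ℕ → ℕ → ℤ) →
  conv (a + suc b) f ≡ conv a (λ k l → f k (l + suc b)) +ℤ conv b (λ k l → f (suc a + k) l)
conv-split zero    b f = refl
conv-split (suc a) b f = trans
  (cong (f 0 (suc a + suc b) +ℤ_) (conv-split a b (λ k l → f (suc k) l)))
  (sym (ℤP.+-assoc (f 0 (suc a + suc b)) _ _))

[_≡_]ℤ : ℕ → ℕ → ℤ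
[ a ≡ b ]ℤ = if a ≡ᵇ b then + 1 else + 0

conv-selectˡ : ∀ k x (g : ℕ → ℕ → ℤ) → conv (k + x) (λ k′ x′ → [ k′ ≡ k ]ℤ *ℤ g k′ x′) ≡ g k x
conv-selectˡ zero    zero    g = ℤP.*-identityˡ _
conv-selectˡ zero    (suc x) g = trans
  (cong₂ _+ℤ_ (ℤP.*-identityˡ (g 0 (suc x))) (conv-0 x (λ k l _ → refl)))
  (ℤP.+-identityʳ _)
conv-selectˡ (suc k) x       g = trans (ℤP.+-identityˡ _) (conv-selectˡ k x (λ k′ → g (suc k′)))

conv-selectʳ : ∀ k x (g : ℕ → ℕ → ℤ) → conv (k + x) (λ k′ x′ → [ x′ ≡ x ]ℤ *ℤ g k′ x′) ≡ g k x
conv-selectʳ k x g = begin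
  conv (k + x) (λ k′ x′ → [ x′ ≡ x ]ℤ *ℤ g k′ x′)  ≡⟨ conv-comm (k + x) _ ⟩
  conv (k + x) (λ x′ k′ → [ x′ ≡ x ]ℤ *ℤ g k′ x′)  ≡⟨ cong (λ n → conv n (λ x′ k′ → [ x′ ≡ x ]ℤ *ℤ g k′ x′)) (ℕP.+-comm k x) ⟩
  conv (x + k) (λ x′ k′ → [ x′ ≡ x ]ℤ *ℤ g k′ x′)  ≡⟨ conv-selectˡ x k (λ x′ k′ → g k′ x′) ⟩
  g k x ∎

Σ<-suc : ∀ n f → Σ< (suc n) f ≡ f 0 +ℤ Σ< n (f ∘ suc)
Σ<-suc n f = cong sumℤ (trans (map-upTo f (suc n)) (cong (f 0 ∷_) (sym (map-upTo (f ∘ suc) n))))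

Σ<-last : ∀ n f → Σ< (suc n) f ≡ Σ< n f +ℤ f n
Σ<-last zero    f = ℤP.+-comm (f 0) (+ 0)
Σ<-last (suc n) f = begin
  Σ< (suc (suc n)) f                        ≡⟨ Σ<-suc (suc n) f ⟩
  f 0 +ℤ Σ< (suc n) (f ∘ suc)               ≡⟨ cong (f 0 +ℤ_) (Σ<-last n (f ∘ suc)) ⟩
  f 0 +ℤ (Σ< n (f ∘ suc) +ℤ f (suc n))      ≡⟨ ℤP.+-assoc (f 0) _ _ ⟨
  f 0 +ℤ Σ< n (f ∘ suc) +ℤ f (suc n)        ≡⟨ cong (_+ℤ f (suc n)) (Σ<-suc n f) ⟨
  Σ< (suc n) f +ℤ f (suc n) ∎

Σ<-cong : ∀ n {f g : ℕ → ℤ} → (∀ h → f h ≡ g h) → Σ< n f ≡ Σ< n g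
Σ<-cong zero    eq = refl
Σ<-cong (suc n) {f} {g} eq =
  trans (Σ<-last n f) (trans (cong₂ _+ℤ_ (Σ<-cong n eq) (eq n)) (sym (Σ<-last n g)))

*P-conv : ∀ p q a → (p *P q) a ≡ conv a (λ k l → p k *ℤ q l)
*P-conv p q zero    = ℤP.+-identityʳ _
*P-conv p q (suc a) = trans (Σ<-suc (suc a) (λ j → p j *ℤ q (suc a ∸ j))) (cong (p 0 *ℤ q (suc a) +ℤ_) (*P-conv (p ∘ suc) q a))

sgn-suc : ∀ k → sgn (suc k) ≡ - sgn k
sgn-suc zero          = refl
sgn-suc (suc zero)    = refl
sgn-suc (suc (suc k)) = sgn-suc k

sgn-+ : ∀ k l → sgn (k + l) ≡ sgn k *ℤ sgn l
sgn-+ zero    l = sym (ℤP.*-identityˡ _)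
sgn-+ (suc k) l = begin
  sgn (suc (k + l))       ≡⟨ sgn-suc (k + l) ⟩
  - sgn (k + l)           ≡⟨ cong -_ (sgn-+ k l) ⟩
  - (sgn k *ℤ sgn l)      ≡⟨ ℤP.neg-distribˡ-* (sgn k) (sgn l) ⟩
  (- sgn k) *ℤ sgn l      ≡⟨ cong (_*ℤ sgn l) (sgn-suc k) ⟨
  sgn (suc k) *ℤ sgn l ∎

sgn-sq : ∀ k → sgn k *ℤ sgn k ≡ + 1
sgn-sq zero          = refl
sgn-sq (suc zero)    = refl
sgn-sq (suc (suc k)) = sgn-sq k

-- Indexing C(k + x, k) by k and x keeps every later sum free of truncated subtraction.
β : ℕ → ℕ → ℤ
β k x = + ((k + x) C k)

β-0ʳ : ∀ k → β k 0 ≡ + 1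
β-0ʳ k = cong +_ (trans (cong (_C k) (ℕP.+-identityʳ k)) (nCn≡1 k))

β-comm : ∀ k x → β k x ≡ β x k
β-comm k x = cong +_ (begin
  (k + x) C k              ≡⟨ nCk≡nC[n∸k] (ℕP.m≤m+n k x) ⟩
  (k + x) C (k + x ∸ k)    ≡⟨ cong ((k + x) C_) (ℕP.m+n∸m≡n k x) ⟩
  (k + x) C x              ≡⟨ cong (_C x) (ℕP.+-comm k x) ⟩
  (x + k) C x ∎)

β-pascal : ∀ k x → β (suc k) (suc x) ≡ β k (suc x) +ℤ β (suc k) x
β-pascal k x = cong +_ (begin
  suc (k + suc x) C suc k                    ≡⟨ nCk+nC[k+1]≡[n+1]C[k+1] (k + suc x) k ⟨
  (k + suc x) C k + (k + suc x) C suc k      ≡⟨ cong (λ n → (k + suc x) C k + n C suc k) (ℕP.+-suc k x) ⟩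
  (k + suc x) C k + (suc k + x) C suc k ∎)

-- Absorption, by induction on k and x: Pascal's rule leaves one term with smaller k and one with
-- smaller x.
β-absorb : ∀ k x → + suc k *ℤ β (suc k) x ≡ + suc (k + x) *ℤ β k x
β-absorb k zero    = cong₂ _*ℤ_ (cong (λ n → + suc n) (sym (ℕP.+-identityʳ k)))
                                (trans (β-0ʳ (suc k)) (sym (β-0ʳ k)))
β-absorb zero (suc x) = begin
  + 1 *ℤ β 1 (suc x)                ≡⟨ ℤP.*-identityˡ _ ⟩
  β 1 (suc x)                       ≡⟨ β-pascal 0 x ⟩
  + 1 +ℤ β 1 x                      ≡⟨ cong (+ 1 +ℤ_) (trans (sym (ℤP.*-identityˡ _)) (β-absorb 0 x)) ⟩
  + 1 +ℤ + suc x *ℤ + 1             ≡⟨ cong (+ 1 +ℤ_) (ℤP.*-identityʳ (+ suc x)) ⟩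
  + suc (suc x)                     ≡⟨ ℤP.*-identityʳ _ ⟨
  + suc (suc x) *ℤ + 1 ∎
β-absorb (suc k) (suc x) = begin
  + suc (suc k) *ℤ β (suc (suc k)) (suc x)
    ≡⟨ cong (+ suc (suc k) *ℤ_) (β-pascal (suc k) x) ⟩
  + suc (suc k) *ℤ (β (suc k) (suc x) +ℤ β (suc (suc k)) x)
    ≡⟨ expand (+ suc k) (β (suc k) (suc x)) (β (suc (suc k)) x) ⟩
  β (suc k) (suc x) +ℤ + suc k *ℤ β (suc k) (suc x) +ℤ + suc (suc k) *ℤ β (suc (suc k)) x
    ≡⟨ cong₂ (λ u v → β (suc k) (suc x) +ℤ u +ℤ v) (β-absorb k (suc x)) (β-absorb (suc k) x) ⟩
  β (suc k) (suc x) +ℤ + suc (k + suc x) *ℤ β k (suc x) +ℤ + suc (suc k + x) *ℤ β (suc k) x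
    ≡⟨ cong (λ n → β (suc k) (suc x) +ℤ + suc (k + suc x) *ℤ β k (suc x) +ℤ + suc n *ℤ β (suc k) x) (ℕP.+-suc k x) ⟨
  β (suc k) (suc x) +ℤ + suc (k + suc x) *ℤ β k (suc x) +ℤ + suc (k + suc x) *ℤ β (suc k) x
    ≡⟨ collect (β (suc k) (suc x)) (+ suc (k + suc x)) (β k (suc x)) (β (suc k) x) ⟩
  β (suc k) (suc x) +ℤ + suc (k + suc x) *ℤ (β k (suc x) +ℤ β (suc k) x)
    ≡⟨ cong (λ z → β (suc k) (suc x) +ℤ + suc (k + suc x) *ℤ z) (β-pascal k x) ⟨
  β (suc k) (suc x) +ℤ + suc (k + suc x) *ℤ β (suc k) (suc x)
    ≡⟨ fold (+ suc (k + suc x)) (β (suc k) (suc x)) ⟩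
  + suc (suc (k + suc x)) *ℤ β (suc k) (suc x) ∎
  where
  expand : ∀ c u v → (+ 1 +ℤ c) *ℤ (u +ℤ v) ≡ u +ℤ c *ℤ u +ℤ (+ 1 +ℤ c) *ℤ v
  expand = solve-∀
  collect : ∀ b c u v → b +ℤ c *ℤ u +ℤ c *ℤ v ≡ b +ℤ c *ℤ (u +ℤ v)
  collect = solve-∀
  fold : ∀ c u → u +ℤ c *ℤ u ≡ (+ 1 +ℤ c) *ℤ u
  fold = solve-∀

β-absorbʳ : ∀ k x → + suc x *ℤ β k (suc x) ≡ + suc (k + x) *ℤ β k x
β-absorbʳ k x = begin
  + suc x *ℤ β k (suc x)      ≡⟨ cong (+ suc x *ℤ_) (β-comm k (suc x)) ⟩
  + suc x *ℤ β (suc x) k      ≡⟨ β-absorb x k ⟩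
  + suc (x + k) *ℤ β x k      ≡⟨ cong₂ (λ n z → + suc n *ℤ z) (ℕP.+-comm x k) (β-comm x k) ⟩
  + suc (k + x) *ℤ β k x ∎

-- Both sides are the trinomial coefficient (k + l + x)! / (k! l! x!).
β-trinomial : ∀ k l x → β k (l + x) *ℤ β l x ≡ β (k + l) x *ℤ β k l
β-trinomial zero    l x = trans (ℤP.*-identityˡ _) (sym (ℤP.*-identityʳ _))
β-trinomial (suc k) l x = ℤP.*-cancelˡ-≡ (+ suc k) _ _ (begin
  + suc k *ℤ (β (suc k) (l + x) *ℤ β l x)            ≡⟨ ℤP.*-assoc (+ suc k) (β (suc k) (l + x)) (β l x) ⟨
  + suc k *ℤ β (suc k) (l + x) *ℤ β l x              ≡⟨ cong (_*ℤ β l x) (β-absorb k (l + x)) ⟩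
  + suc (k + (l + x)) *ℤ β k (l + x) *ℤ β l x        ≡⟨ ℤP.*-assoc (+ suc (k + (l + x))) (β k (l + x)) (β l x) ⟩
  + suc (k + (l + x)) *ℤ (β k (l + x) *ℤ β l x)      ≡⟨ cong₂ (λ n z → + suc n *ℤ z) (sym (ℕP.+-assoc k l x)) (β-trinomial k l x) ⟩
  + suc (k + l + x) *ℤ (β (k + l) x *ℤ β k l)        ≡⟨ ℤP.*-assoc (+ suc (k + l + x)) (β (k + l) x) (β k l) ⟨
  + suc (k + l + x) *ℤ β (k + l) x *ℤ β k l          ≡⟨ cong (_*ℤ β k l) (β-absorb (k + l) x) ⟨
  + suc (k + l) *ℤ β (suc (k + l)) x *ℤ β k l        ≡⟨ rearrange (+ suc (k + l)) (β (suc (k + l)) x) (β k l) ⟩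
  β (suc (k + l)) x *ℤ (+ suc (k + l) *ℤ β k l)      ≡⟨ cong (β (suc (k + l)) x *ℤ_) (β-absorb k l) ⟨
  β (suc (k + l)) x *ℤ (+ suc k *ℤ β (suc k) l)      ≡⟨ rearrange (+ suc k) (β (suc (k + l)) x) (β (suc k) l) ⟨
  + suc k *ℤ β (suc (k + l)) x *ℤ β (suc k) l        ≡⟨ ℤP.*-assoc (+ suc k) (β (suc (k + l)) x) (β (suc k) l) ⟩
  + suc k *ℤ (β (suc k + l) x *ℤ β (suc k) l) ∎)
  where
  rearrange : ∀ a b c → a *ℤ b *ℤ c ≡ b *ℤ (a *ℤ c)
  rearrange = solve-∀

-- The trinomial coefficient of `β-trinomial` is symmetric in k and l.
β-exchange : ∀ k l x → β k (l + x) *ℤ β l x ≡ β l (k + x) *ℤ β k x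
β-exchange k l x = begin
  β k (l + x) *ℤ β l x    ≡⟨ β-trinomial k l x ⟩
  β (k + l) x *ℤ β k l    ≡⟨ cong₂ (λ n z → β n x *ℤ z) (ℕP.+-comm k l) (β-comm k l) ⟩
  β (l + k) x *ℤ β l k    ≡⟨ β-trinomial l k x ⟨
  β l (k + x) *ℤ β k x ∎

-- Alternating binomial sums and binomial inversion

alternating-partial-sum : ∀ a μ → conv a (λ k l → sgn k *ℤ β k (l + suc μ)) ≡ sgn a *ℤ β a μ
alternating-partial-sum zero    μ = refl
alternating-partial-sum (suc a) μ = begin
  conv (suc a) (λ k l → sgn k *ℤ β k (l + suc μ))
    ≡⟨ conv-last a (λ k l → sgn k *ℤ β k (l + suc μ)) ⟩
  conv a (λ k l → sgn k *ℤ β k (suc l + suc μ)) +ℤ sgn (suc a) *ℤ β (suc a) (suc μ)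
    -- Moving the shift of l into `suc μ` raises μ by one, so the induction on a runs over all μ.
    -- Pascal's rule on the last term then cancels the inductive value.
    ≡⟨ cong₂ _+ℤ_ (conv-cong a (λ k l _ → cong (λ n → sgn k *ℤ β k n) (sym (ℕP.+-suc l (suc μ)))))
                  (cong₂ _*ℤ_ (sgn-suc a) (β-pascal a μ)) ⟩
  conv a (λ k l → sgn k *ℤ β k (l + suc (suc μ))) +ℤ (- sgn a) *ℤ (β a (suc μ) +ℤ β (suc a) μ)
    ≡⟨ cong (_+ℤ (- sgn a) *ℤ (β a (suc μ) +ℤ β (suc a) μ)) (alternating-partial-sum a (suc μ)) ⟩
  sgn a *ℤ β a (suc μ) +ℤ (- sgn a) *ℤ (β a (suc μ) +ℤ β (suc a) μ)
    ≡⟨ cancel (sgn a) (β a (suc μ)) (β (suc a) μ) ⟩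
  (- sgn a) *ℤ β (suc a) μ
    ≡⟨ cong (_*ℤ β (suc a) μ) (sgn-suc a) ⟨
  sgn (suc a) *ℤ β (suc a) μ ∎
  where
  cancel : ∀ s u v → s *ℤ u +ℤ (- s) *ℤ (u +ℤ v) ≡ (- s) *ℤ v
  cancel = solve-∀

-- This is (1 - 1)^a. For a > 0 the terms before the last form a partial sum with μ = 0, whose value
-- cancels the last term.
alternating-sum : ∀ a → conv a (λ k l → sgn k *ℤ β k l) ≡ [ a ≡ 0 ]ℤ
alternating-sum zero    = refl
alternating-sum (suc a) = begin
  conv (suc a) (λ k l → sgn k *ℤ β k l)
    ≡⟨ conv-last a (λ k l → sgn k *ℤ β k l) ⟩
  conv a (λ k l → sgn k *ℤ β k (suc l)) +ℤ sgn (suc a) *ℤ β (suc a) 0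
    ≡⟨ cong₂ _+ℤ_ (conv-cong a (λ k l _ → cong (λ n → sgn k *ℤ β k n) (sym (ℕP.+-comm l 1))))
                  (cong₂ _*ℤ_ (sgn-suc a) (β-0ʳ (suc a))) ⟩
  conv a (λ k l → sgn k *ℤ β k (l + 1)) +ℤ (- sgn a) *ℤ + 1
    ≡⟨ cong (_+ℤ (- sgn a) *ℤ + 1) (trans (alternating-partial-sum a 0) (cong (sgn a *ℤ_) (β-0ʳ a))) ⟩
  sgn a *ℤ + 1 +ℤ (- sgn a) *ℤ + 1
    ≡⟨ cancel (sgn a) ⟩
  + 0 ∎
  where
  cancel : ∀ s → s *ℤ + 1 +ℤ (- s) *ℤ + 1 ≡ + 0
  cancel = solve-∀

alternating-sumʳ : ∀ a → conv a (λ k l → sgn l *ℤ β k l) ≡ [ a ≡ 0 ]ℤ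
alternating-sumʳ a = begin
  conv a (λ k l → sgn l *ℤ β k l)  ≡⟨ conv-comm a _ ⟩
  conv a (λ k l → sgn k *ℤ β l k)  ≡⟨ conv-cong a (λ k l _ → cong (sgn k *ℤ_) (β-comm l k)) ⟩
  conv a (λ k l → sgn k *ℤ β k l)  ≡⟨ alternating-sum a ⟩
  [ a ≡ 0 ]ℤ ∎

-- The trinomial identity separates the composite of the two transforms into `β x (q + c)` and the
-- convolution of `f` with `g`, which is a Kronecker delta by hypothesis. The transform is assumed
-- only for l ≤ a because `S-high` can supply it only on an initial range.
binomial-inversion : ∀ c (f g u v : ℕ → ℤ) →
  (∀ x → conv x (λ k p → f k *ℤ g p *ℤ β k p) ≡ [ x ≡ 0 ]ℤ) → ∀ a →
  (∀ l → l ≤ a → v l ≡ conv l (λ p q → g p *ℤ β p (q + c) *ℤ u q)) →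
  conv a (λ k l → f k *ℤ β k (l + c) *ℤ v l) ≡ u a
binomial-inversion c f g u v inverse a transform = begin
  conv a (λ k l → f k *ℤ β k (l + c) *ℤ v l)
    ≡⟨ conv-cong a (λ k l k+l≡a → trans
         (cong (f k *ℤ β k (l + c) *ℤ_) (transform l (subst (l ≤_) k+l≡a (ℕP.m≤n+m l k))))
         (sym (conv-*ˡ l (f k *ℤ β k (l + c)) _))) ⟩
  conv a (λ k l → conv l (λ p q → f k *ℤ β k (l + c) *ℤ (g p *ℤ β p (q + c) *ℤ u q)))
    ≡⟨ conv-cong a (λ k l _ → conv-cong l (λ p q p+q≡l → regroup k l p q p+q≡l)) ⟩
  conv a (λ k l → conv l (λ p q → f k *ℤ g p *ℤ β k p *ℤ (β (k + p) (q + c) *ℤ u q)))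
    ≡⟨ conv-assoc a (λ k p q → f k *ℤ g p *ℤ β k p *ℤ (β (k + p) (q + c) *ℤ u q)) ⟩
  conv a (λ x q → conv x (λ k p → f k *ℤ g p *ℤ β k p *ℤ (β (k + p) (q + c) *ℤ u q)))
    ≡⟨ conv-cong a (λ x q _ → trans
         (conv-cong x (λ k p k+p≡x → cong (λ n → f k *ℤ g p *ℤ β k p *ℤ (β n (q + c) *ℤ u q)) k+p≡x))
         (trans (conv-*ʳ x (β x (q + c) *ℤ u q) _) (cong (_*ℤ (β x (q + c) *ℤ u q)) (inverse x)))) ⟩
  conv a (λ x q → [ x ≡ 0 ]ℤ *ℤ (β x (q + c) *ℤ u q))
    ≡⟨ conv-selectˡ 0 a (λ x q → β x (q + c) *ℤ u q) ⟩
  + 1 *ℤ u a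
    ≡⟨ ℤP.*-identityˡ (u a) ⟩
  u a ∎
  where
  pair : ∀ a b c d e → a *ℤ b *ℤ (c *ℤ d *ℤ e) ≡ a *ℤ c *ℤ (b *ℤ d) *ℤ e
  pair = solve-∀
  unpair : ∀ a c x y e → a *ℤ c *ℤ (x *ℤ y) *ℤ e ≡ a *ℤ c *ℤ y *ℤ (x *ℤ e)
  unpair = solve-∀
  regroup : ∀ k l p q → p + q ≡ l →
    f k *ℤ β k (l + c) *ℤ (g p *ℤ β p (q + c) *ℤ u q) ≡ f k *ℤ g p *ℤ β k p *ℤ (β (k + p) (q + c) *ℤ u q)
  regroup k l p q refl = begin
    f k *ℤ β k (p + q + c) *ℤ (g p *ℤ β p (q + c) *ℤ u q)
      ≡⟨ pair (f k) (β k (p + q + c)) (g p) (β p (q + c)) (u q) ⟩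
    f k *ℤ g p *ℤ (β k (p + q + c) *ℤ β p (q + c)) *ℤ u q
      ≡⟨ cong (λ n → f k *ℤ g p *ℤ (β k n *ℤ β p (q + c)) *ℤ u q) (ℕP.+-assoc p q c) ⟩
    f k *ℤ g p *ℤ (β k (p + (q + c)) *ℤ β p (q + c)) *ℤ u q
      ≡⟨ cong (λ z → f k *ℤ g p *ℤ z *ℤ u q) (β-trinomial k p (q + c)) ⟩
    f k *ℤ g p *ℤ (β (k + p) (q + c) *ℤ β k p) *ℤ u q
      ≡⟨ unpair (f k) (g p) (β (k + p) (q + c)) (β k p) (u q) ⟩
    f k *ℤ g p *ℤ β k p *ℤ (β (k + p) (q + c) *ℤ u q) ∎

-- The closed form

-- At i = h = 0 the truncated i + h ∸ 1 is harmless: C(0,0) = 1 = C(-1,0).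
summand : ℕ → ℕ → ℕ → ℤ
summand D i h = + ((D + h) C (h + i + 1)) *ℤ + ((i + h ∸ 1) C h)

-- Induction on μ with Pascal's rule used twice: first the second factors combine to C(h + i, i),
-- then the first factors, whose bottoms are consecutive, combine to a binomial with top D + h + 1.
summand-telescopes : ∀ D i μ →
  Σ< (suc μ) (summand D i) +ℤ Σ< (suc μ) (summand D (suc i))
    ≡ + ((D + suc μ) C (suc μ + i + 1)) *ℤ + ((μ + i) C i)
summand-telescopes D i zero = begin
  + ((D + 0) C (i + 1)) *ℤ + 1 +ℤ + 0 +ℤ (+ ((D + 0) C (suc i + 1)) *ℤ + 1 +ℤ + 0)
    ≡⟨ simplify (+ ((D + 0) C (i + 1))) (+ ((D + 0) C (suc i + 1))) ⟩
  + ((D + 0) C (i + 1)) +ℤ + ((D + 0) C suc (i + 1))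
    ≡⟨ cong +_ (nCk+nC[k+1]≡[n+1]C[k+1] (D + 0) (i + 1)) ⟩
  + (suc (D + 0) C suc (i + 1))
    ≡⟨ cong (λ n → + (n C suc (i + 1))) (sym (ℕP.+-suc D 0)) ⟩
  + ((D + 1) C (1 + i + 1))
    ≡⟨ ℤP.*-identityʳ _ ⟨
  + ((D + 1) C (1 + i + 1)) *ℤ + 1
    ≡⟨ cong (λ n → + ((D + 1) C (1 + i + 1)) *ℤ + n) (nCn≡1 i) ⟨
  + ((D + 1) C (1 + i + 1)) *ℤ + (i C i) ∎
  where
  simplify : ∀ u v → u *ℤ + 1 +ℤ + 0 +ℤ (v *ℤ + 1 +ℤ + 0) ≡ u +ℤ v
  simplify = solve-∀
summand-telescopes D i (suc μ) = begin
  Σ< (suc h) (summand D i) +ℤ Σ< (suc h) (summand D (suc i))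
    ≡⟨ cong₂ _+ℤ_ (Σ<-last h (summand D i)) (Σ<-last h (summand D (suc i))) ⟩
  Σ< h (summand D i) +ℤ summand D i h +ℤ (Σ< h (summand D (suc i)) +ℤ summand D (suc i) h)
    ≡⟨ +-interchange (Σ< h (summand D i)) (summand D i h) _ _ ⟩
  Σ< h (summand D i) +ℤ Σ< h (summand D (suc i)) +ℤ (summand D i h +ℤ summand D (suc i) h)
    ≡⟨ cong₂ _+ℤ_ (trans (summand-telescopes D i μ) (cong (λ z → X *ℤ z) (β-comm′ μ)))
                  (cong₂ _+ℤ_ (cong (λ n → X *ℤ + (n C h)) (cong (_∸ 1) (ℕP.+-suc i μ)))
                              (cong₂ (λ n z → + ((D + h) C n) *ℤ z) (cong (_+ 1) (ℕP.+-suc h i)) (β-comm″))) ⟩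
  X *ℤ + ((i + μ) C μ) +ℤ (X *ℤ + ((i + μ) C h) +ℤ Y *ℤ + ((h + i) C i))
    ≡⟨ collect X Y (+ ((i + μ) C μ)) (+ ((i + μ) C h)) (+ ((h + i) C i)) ⟩
  X *ℤ (+ ((i + μ) C μ) +ℤ + ((i + μ) C h)) +ℤ Y *ℤ + ((h + i) C i)
    ≡⟨ cong (λ z → X *ℤ z +ℤ Y *ℤ + ((h + i) C i)) pascal ⟩
  X *ℤ + ((h + i) C i) +ℤ Y *ℤ + ((h + i) C i)
    ≡⟨ ℤP.*-distribʳ-+ (+ ((h + i) C i)) X Y ⟨
  (X +ℤ Y) *ℤ + ((h + i) C i)
    ≡⟨ cong (λ n → + n *ℤ + ((h + i) C i)) (nCk+nC[k+1]≡[n+1]C[k+1] (D + h) (h + i + 1)) ⟩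
  + (suc (D + h) C suc (h + i + 1)) *ℤ + ((h + i) C i)
    ≡⟨ cong (λ n → + (n C suc (h + i + 1)) *ℤ + ((h + i) C i)) (sym (ℕP.+-suc D h)) ⟩
  + ((D + suc h) C (suc h + i + 1)) *ℤ + ((h + i) C i) ∎
  where
  h = suc μ
  X = + ((D + h) C (h + i + 1))
  Y = + ((D + h) C suc (h + i + 1))
  β-comm′ : ∀ μ → + ((μ + i) C i) ≡ + ((i + μ) C μ)
  β-comm′ μ = trans (cong (λ n → + (n C i)) (ℕP.+-comm μ i))
                (trans (β-comm i μ) (cong (λ n → + (n C μ)) (ℕP.+-comm μ i)))
  β-comm″ : + ((i + h) C h) ≡ + ((h + i) C i)
  β-comm″ = sym (β-comm′ h)
  pascal : + ((i + μ) C μ) +ℤ + ((i + μ) C h) ≡ + ((h + i) C i)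
  pascal = trans (cong +_ (nCk+nC[k+1]≡[n+1]C[k+1] (i + μ) μ))
             (trans (cong (λ n → + (n C h)) (sym (ℕP.+-suc i μ))) β-comm″)
  collect : ∀ x y a b c → x *ℤ a +ℤ (x *ℤ b +ℤ y *ℤ c) ≡ x *ℤ (a +ℤ b) +ℤ y *ℤ c
  collect = solve-∀

module _ (μ : ℕ) where

  -- With D = r + i, m = μ + 1 and j = l + i + 1 this is the sum of (-1)^(j-i-1) C(D+m, D-j) C(j+μ,
  -- μ) over i < j ≤ D. It is the part of the inverted transform that has no immediate closed form.
  altSum : ℕ → ℕ → ℤ
  altSum zero    i = + 0
  altSum (suc r) i = conv r (λ k l → sgn l *ℤ (β k (l + suc i + suc μ) *ℤ β (l + suc i) μ))

  -- Both sums have the same D. Passing from i to i + 1 drops the term j = i + 1 and negates all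
  -- others, so only that term survives.
  altSum-step : ∀ ρ i → altSum (suc ρ) i +ℤ altSum ρ (suc i) ≡ β ρ (suc i + suc μ) *ℤ β (suc i) μ
  altSum-step zero    i = trans (ℤP.+-identityʳ _) (ℤP.*-identityˡ _)
  altSum-step (suc r) i = begin
    conv (suc r) (t i) +ℤ conv r (t (suc i))
      ≡⟨ cong (_+ℤ conv r (t (suc i))) (conv-last r (t i)) ⟩
    conv r (λ k l → t i k (suc l)) +ℤ t i (suc r) 0 +ℤ conv r (t (suc i))
      ≡⟨ cong (λ z → z +ℤ t i (suc r) 0 +ℤ conv r (t (suc i))) (trans (conv-cong r (λ k l _ → shift k l)) (conv-*ˡ r (- (+ 1)) (t (suc i)))) ⟩
    - (+ 1) *ℤ conv r (t (suc i)) +ℤ t i (suc r) 0 +ℤ conv r (t (suc i))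
      ≡⟨ cancel (conv r (t (suc i))) (β (suc r) (suc i + suc μ) *ℤ β (suc i) μ) ⟩
    β (suc r) (suc i + suc μ) *ℤ β (suc i) μ ∎
    where
    t : ℕ → ℕ → ℕ → ℤ
    t i k l = sgn l *ℤ (β k (l + suc i + suc μ) *ℤ β (l + suc i) μ)
    shift : ∀ k l → t i k (suc l) ≡ - (+ 1) *ℤ t (suc i) k l
    shift k l = begin
      sgn (suc l) *ℤ (β k (suc l + suc i + suc μ) *ℤ β (suc l + suc i) μ)
        ≡⟨ cong₂ (λ s n → s *ℤ (β k (n + suc μ) *ℤ β n μ)) (sgn-suc l) (sym (ℕP.+-suc l (suc i))) ⟩
      (- sgn l) *ℤ (β k (l + suc (suc i) + suc μ) *ℤ β (l + suc (suc i)) μ)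
        ≡⟨ neg (sgn l) _ ⟩
      - (+ 1) *ℤ t (suc i) k l ∎
      where
      neg : ∀ s x → (- s) *ℤ x ≡ - (+ 1) *ℤ (s *ℤ x)
      neg = solve-∀
    cancel : ∀ x y → - (+ 1) *ℤ x +ℤ + 1 *ℤ y +ℤ x ≡ y
    cancel = solve-∀

  -- For d = ρ + 2i with ρ > 0 this is D / C(d+m, i) times the coefficient of t^i in q_d, where D =
  -- ρ + i = d - i; see `Q-formula`.
  reduced : ℕ → ℕ → ℤ
  reduced ρ i = + ρ *ℤ (β ρ (i + suc μ) *ℤ β i μ) - + (ρ + i) *ℤ altSum ρ i

  -- Absorption in both directions turns (ρ + 1) `β (suc ρ) (i + suc μ)` into a multiple of
  -- `β ρ (suc i + suc μ)`, which becomes a common factor. A second absorption collapses the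
  -- remaining bracket to `β i μ`.
  reduced-step : ∀ ρ i → reduced (suc ρ) i +ℤ reduced ρ (suc i) ≡ β ρ (suc i + suc μ) *ℤ β i μ
  reduced-step ρ i = begin
    + suc ρ *ℤ (β (suc ρ) (i + suc μ) *ℤ β i μ) - + (suc ρ + i) *ℤ altSum (suc ρ) i +ℤ
      (+ ρ *ℤ (β ρ (suc i + suc μ) *ℤ β (suc i) μ) - + (ρ + suc i) *ℤ altSum ρ (suc i))
      ≡⟨ cong (λ n → + suc ρ *ℤ (β (suc ρ) (i + suc μ) *ℤ β i μ) - + n *ℤ altSum (suc ρ) i +ℤ
           (+ ρ *ℤ (β ρ (suc i + suc μ) *ℤ β (suc i) μ) - + (ρ + suc i) *ℤ altSum ρ (suc i))) (sym (ℕP.+-suc ρ i)) ⟩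
    + suc ρ *ℤ (β (suc ρ) (i + suc μ) *ℤ β i μ) - (+ ρ +ℤ + suc i) *ℤ altSum (suc ρ) i +ℤ
      (+ ρ *ℤ (β ρ (suc i + suc μ) *ℤ β (suc i) μ) - (+ ρ +ℤ + suc i) *ℤ altSum ρ (suc i))
      ≡⟨ collect (+ suc ρ) (+ ρ) (+ suc i) (β (suc ρ) (i + suc μ)) (β i μ) (β ρ (suc i + suc μ)) (β (suc i) μ) (altSum (suc ρ) i) (altSum ρ (suc i)) ⟩
    (+ suc ρ *ℤ β (suc ρ) (i + suc μ)) *ℤ β i μ +ℤ + ρ *ℤ (β ρ (suc i + suc μ) *ℤ β (suc i) μ)
      - (+ ρ +ℤ + suc i) *ℤ (altSum (suc ρ) i +ℤ altSum ρ (suc i))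
      ≡⟨ cong₂ (λ u v → u *ℤ β i μ +ℤ + ρ *ℤ (β ρ (suc i + suc μ) *ℤ β (suc i) μ) - (+ ρ +ℤ + suc i) *ℤ v)
           (trans (β-absorb ρ (i + suc μ)) (sym (β-absorbʳ ρ (i + suc μ)))) (altSum-step ρ i) ⟩
    (+ suc (i + suc μ) *ℤ β ρ (suc i + suc μ)) *ℤ β i μ +ℤ + ρ *ℤ (β ρ (suc i + suc μ) *ℤ β (suc i) μ)
      - (+ ρ +ℤ + suc i) *ℤ (β ρ (suc i + suc μ) *ℤ β (suc i) μ)
      ≡⟨ simplify (+ (i + suc μ)) (+ ρ) (+ suc i) (β ρ (suc i + suc μ)) (β i μ) (β (suc i) μ) ⟩
    β ρ (suc i + suc μ) *ℤ (β i μ +ℤ + (i + suc μ) *ℤ β i μ - + suc i *ℤ β (suc i) μ)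
      ≡⟨ cong (λ z → β ρ (suc i + suc μ) *ℤ (β i μ +ℤ + (i + suc μ) *ℤ β i μ - z))
              (trans (β-absorb i μ) (cong (λ n → + n *ℤ β i μ) (sym (ℕP.+-suc i μ)))) ⟩
    β ρ (suc i + suc μ) *ℤ (β i μ +ℤ + (i + suc μ) *ℤ β i μ - + (i + suc μ) *ℤ β i μ)
      ≡⟨ cancel (β ρ (suc i + suc μ)) (β i μ) (+ (i + suc μ) *ℤ β i μ) ⟩
    β ρ (suc i + suc μ) *ℤ β i μ ∎
    where
    collect : ∀ s r d a b c e x y →
      s *ℤ (a *ℤ b) - (r +ℤ d) *ℤ x +ℤ (r *ℤ (c *ℤ e) - (r +ℤ d) *ℤ y)
        ≡ s *ℤ a *ℤ b +ℤ r *ℤ (c *ℤ e) - (r +ℤ d) *ℤ (x +ℤ y)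
    collect = solve-∀
    simplify : ∀ n r d a b c →
      (+ 1 +ℤ n) *ℤ a *ℤ b +ℤ r *ℤ (a *ℤ c) - (r +ℤ d) *ℤ (a *ℤ c) ≡ a *ℤ (b +ℤ n *ℤ b - d *ℤ c)
    simplify = solve-∀
    cancel : ∀ a b c → a *ℤ (b +ℤ c - c) ≡ a *ℤ b
    cancel = solve-∀

  rhsSum : ℕ → ℕ → ℤ
  rhsSum ρ i = Σ< (suc μ) (summand (ρ + i) i)

  rhsSum-step : ∀ ρ i → rhsSum (suc ρ) i +ℤ rhsSum ρ (suc i) ≡ β ρ (suc i + suc μ) *ℤ β i μ
  rhsSum-step ρ i = begin
    Σ< (suc μ) (summand (suc ρ + i) i) +ℤ Σ< (suc μ) (summand (ρ + suc i) (suc i))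
      ≡⟨ cong (λ n → Σ< (suc μ) (summand n i) +ℤ Σ< (suc μ) (summand (ρ + suc i) (suc i))) (sym (ℕP.+-suc ρ i)) ⟩
    Σ< (suc μ) (summand (ρ + suc i) i) +ℤ Σ< (suc μ) (summand (ρ + suc i) (suc i))
      ≡⟨ summand-telescopes (ρ + suc i) i μ ⟩
    + ((ρ + suc i + suc μ) C (suc μ + i + 1)) *ℤ + ((μ + i) C i)
      ≡⟨ cong₂ (λ n k → + (n C k) *ℤ + ((μ + i) C i)) (top ρ i (suc μ)) (bottom i (suc μ)) ⟩
    β (suc i + suc μ) ρ *ℤ + ((μ + i) C i)
      ≡⟨ cong₂ _*ℤ_ (β-comm (suc i + suc μ) ρ) (cong (λ n → + (n C i)) (ℕP.+-comm μ i)) ⟩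
    β ρ (suc i + suc μ) *ℤ β i μ ∎
    where
    top : ∀ ρ i m → ρ + suc i + m ≡ suc i + m + ρ
    top = ℕSolver.solve-∀
    bottom : ∀ i m → m + i + 1 ≡ suc i + m
    bottom = ℕSolver.solve-∀

  -- Here D = i, so the first binomial of every summand has its bottom one above its top.
  rhsSum-0 : ∀ i → rhsSum 0 i ≡ + 0
  rhsSum-0 i = vanish (suc μ)
    where
    vanish : ∀ n → Σ< n (summand i i) ≡ + 0
    vanish zero    = refl
    vanish (suc n) = begin
      Σ< (suc n) (summand i i)       ≡⟨ Σ<-last n (summand i i) ⟩
      Σ< n (summand i i) +ℤ summand i i n
        ≡⟨ cong₂ _+ℤ_ (vanish n) (cong (λ c → + c *ℤ + ((i + n ∸ 1) C n))
             (k>n⇒nCk≡0 (ℕP.≤-reflexive (rearrange i n)))) ⟩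
      + 0 +ℤ + 0 *ℤ + ((i + n ∸ 1) C n)  ≡⟨⟩
      + 0 ∎
      where
      rearrange : ∀ i n → suc (i + n) ≡ n + i + 1
      rearrange = ℕSolver.solve-∀

  -- Induction on ρ along the line where ρ + i is constant: both sides vanish at ρ = 0 and have the
  -- same sum of neighbouring values.
  reduced≡rhsSum : ∀ ρ i → reduced ρ i ≡ rhsSum ρ i
  reduced≡rhsSum zero    i = trans (vanish (β 0 (i + suc μ) *ℤ β i μ) (+ i)) (sym (rhsSum-0 i))
    where
    vanish : ∀ x y → + 0 *ℤ x - y *ℤ + 0 ≡ + 0
    vanish = solve-∀
  reduced≡rhsSum (suc ρ) i = ℤG.∙-cancelʳ (rhsSum ρ (suc i)) _ _ (begin
    reduced (suc ρ) i +ℤ rhsSum ρ (suc i)    ≡⟨ cong (reduced (suc ρ) i +ℤ_) (reduced≡rhsSum ρ (suc i)) ⟨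
    reduced (suc ρ) i +ℤ reduced ρ (suc i)   ≡⟨ trans (reduced-step ρ i) (sym (rhsSum-step ρ i)) ⟩
    rhsSum (suc ρ) i +ℤ rhsSum ρ (suc i) ∎)

-- (t - 1)^j, the characteristic polynomial of the Boolean matroid of rank j.
boolPoly : ℕ → Poly
boolPoly j k = conv j (λ s s′ → β s s′ *ℤ ([ s′ ≡ k ]ℤ *ℤ sgn s))

-- The coefficient of t^a in the characteristic polynomial of the uniform matroid of rank δ + a on
-- suc μ + δ + a elements.
uniformPoly : ℕ → ℕ → ℕ → ℤ
uniformPoly μ δ a = sgn δ *ℤ (β δ (a + suc μ) - [ a ≡ 0 ]ℤ *ℤ β δ μ)

-- Solving the recursion in the rank

module Recursion (μ : ℕ) (Q : ℕ → Poly)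
  (degree : ∀ d i → d ≤ i + i → Q d i ≡ + 0)
  (recursion : ∀ δ a → 0 < δ → Q (δ + a) δ ≡
    uniformPoly μ δ a +ℤ conv (δ + a) (λ j e → β j (e + suc μ) *ℤ (boolPoly j *P Q e) a))
  where

  -- The coefficient of t^i in the binomial transform s_d.
  S : ℕ → ℕ → ℤ
  S d i = conv d (λ k e → sgn k *ℤ β k (e + suc μ) *ℤ Q e i)

  -- Expanding (t - 1)^j into terms C(j, s) (-1)^s t^(s′) with s + s′ = j and summing first over s +
  -- e = x assembles s_x, since the trinomial identity factors the two binomials into
  -- `β s′ (x + suc μ)` and `β s (e + suc μ)`. Reading off t^a then fixes s′ = k and x = δ + l.
  regroup : ∀ δ a →
    conv (δ + a) (λ j e → β j (e + suc μ) *ℤ (boolPoly j *P Q e) a) ≡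
    conv a (λ k l → + 1 *ℤ β k (l + (δ + suc μ)) *ℤ S (δ + l) l)
  regroup δ a = begin
    conv d (λ j e → β j (e + suc μ) *ℤ (boolPoly j *P Q e) a)
      ≡⟨ conv-cong d (λ j e _ → expand j e) ⟩
    conv d (λ j e → conv j (λ s′ s → conv a (λ k l → [ s′ ≡ k ]ℤ *ℤ T s′ s e l)))
      ≡⟨ conv-assoc d (λ s′ s e → conv a (λ k l → [ s′ ≡ k ]ℤ *ℤ T s′ s e l)) ⟨
    conv d (λ s′ x → conv x (λ s e → conv a (λ k l → [ s′ ≡ k ]ℤ *ℤ T s′ s e l)))
      ≡⟨ conv-cong d (λ s′ x _ → contract-inner s′ x) ⟩
    conv d (λ s′ x → conv a (λ k l → [ s′ ≡ k ]ℤ *ℤ (β s′ (x + suc μ) *ℤ S x l)))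
      ≡⟨ conv-swap d a (λ s′ x k l → [ s′ ≡ k ]ℤ *ℤ (β s′ (x + suc μ) *ℤ S x l)) ⟩
    conv a (λ k l → conv d (λ s′ x → [ s′ ≡ k ]ℤ *ℤ (β s′ (x + suc μ) *ℤ S x l)))
      ≡⟨ conv-cong a select ⟩
    conv a (λ k l → + 1 *ℤ β k (l + (δ + suc μ)) *ℤ S (δ + l) l) ∎
    where
    d = δ + a
    T : ℕ → ℕ → ℕ → ℕ → ℤ
    T s′ s e l = β (s + s′) (e + suc μ) *ℤ β s s′ *ℤ sgn s *ℤ Q e l

    expand : ∀ j e → β j (e + suc μ) *ℤ (boolPoly j *P Q e) a ≡
      conv j (λ s′ s → conv a (λ k l → [ s′ ≡ k ]ℤ *ℤ T s′ s e l))
    expand j e = begin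
      β j (e + suc μ) *ℤ (boolPoly j *P Q e) a
        ≡⟨ cong (β j (e + suc μ) *ℤ_) (*P-conv (boolPoly j) (Q e) a) ⟩
      β j (e + suc μ) *ℤ conv a (λ k l → boolPoly j k *ℤ Q e l)
        ≡⟨ conv-*ˡ a (β j (e + suc μ)) (λ k l → boolPoly j k *ℤ Q e l) ⟨
      conv a (λ k l → β j (e + suc μ) *ℤ (boolPoly j k *ℤ Q e l))
        ≡⟨ conv-cong a (λ k l _ → trans
             (cong (β j (e + suc μ) *ℤ_) (sym (conv-*ʳ j (Q e l) (λ s s′ → β s s′ *ℤ ([ s′ ≡ k ]ℤ *ℤ sgn s)))))
             (sym (conv-*ˡ j (β j (e + suc μ)) (λ s s′ → β s s′ *ℤ ([ s′ ≡ k ]ℤ *ℤ sgn s) *ℤ Q e l)))) ⟩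
      conv a (λ k l → conv j (λ s s′ → β j (e + suc μ) *ℤ (β s s′ *ℤ ([ s′ ≡ k ]ℤ *ℤ sgn s) *ℤ Q e l)))
        ≡⟨ conv-swap a j (λ k l s s′ → β j (e + suc μ) *ℤ (β s s′ *ℤ ([ s′ ≡ k ]ℤ *ℤ sgn s) *ℤ Q e l)) ⟩
      conv j (λ s s′ → conv a (λ k l → β j (e + suc μ) *ℤ (β s s′ *ℤ ([ s′ ≡ k ]ℤ *ℤ sgn s) *ℤ Q e l)))
        ≡⟨ conv-cong j (λ { s s′ refl → conv-cong a (λ k l _ →
             rearrange (β (s + s′) (e + suc μ)) (β s s′) [ s′ ≡ k ]ℤ (sgn s) (Q e l)) }) ⟩
      conv j (λ s s′ → conv a (λ k l → [ s′ ≡ k ]ℤ *ℤ T s′ s e l))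
        ≡⟨ conv-comm j (λ s s′ → conv a (λ k l → [ s′ ≡ k ]ℤ *ℤ T s′ s e l)) ⟩
      conv j (λ s′ s → conv a (λ k l → [ s′ ≡ k ]ℤ *ℤ T s′ s e l)) ∎
      where
      rearrange : ∀ x y z s q → x *ℤ (y *ℤ (z *ℤ s) *ℤ q) ≡ z *ℤ (x *ℤ y *ℤ s *ℤ q)
      rearrange = solve-∀

    contract-inner : ∀ s′ x →
      conv x (λ s e → conv a (λ k l → [ s′ ≡ k ]ℤ *ℤ T s′ s e l)) ≡
      conv a (λ k l → [ s′ ≡ k ]ℤ *ℤ (β s′ (x + suc μ) *ℤ S x l))
    contract-inner s′ x = begin
      conv x (λ s e → conv a (λ k l → [ s′ ≡ k ]ℤ *ℤ T s′ s e l))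
        ≡⟨ conv-swap x a (λ s e k l → [ s′ ≡ k ]ℤ *ℤ T s′ s e l) ⟩
      conv a (λ k l → conv x (λ s e → [ s′ ≡ k ]ℤ *ℤ T s′ s e l))
        ≡⟨ conv-cong a (λ k l _ → trans (conv-*ˡ x [ s′ ≡ k ]ℤ (λ s e → T s′ s e l))
             (cong ([ s′ ≡ k ]ℤ *ℤ_) (trans (conv-cong x (λ s e s+e≡x → split s e l s+e≡x))
               (conv-*ˡ x (β s′ (x + suc μ)) (λ s e → sgn s *ℤ β s (e + suc μ) *ℤ Q e l))))) ⟩
      conv a (λ k l → [ s′ ≡ k ]ℤ *ℤ (β s′ (x + suc μ) *ℤ S x l)) ∎
      where
      rearrange : ∀ x y s q → x *ℤ y *ℤ s *ℤ q ≡ x *ℤ (s *ℤ y *ℤ q)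
      rearrange = solve-∀
      split : ∀ s e l → s + e ≡ x → T s′ s e l ≡ β s′ (x + suc μ) *ℤ (sgn s *ℤ β s (e + suc μ) *ℤ Q e l)
      split s e l refl = begin
        β (s + s′) (e + suc μ) *ℤ β s s′ *ℤ sgn s *ℤ Q e l
          ≡⟨ cong₂ (λ n z → β n (e + suc μ) *ℤ z *ℤ sgn s *ℤ Q e l) (ℕP.+-comm s s′) (β-comm s s′) ⟩
        β (s′ + s) (e + suc μ) *ℤ β s′ s *ℤ sgn s *ℤ Q e l
          ≡⟨ cong (λ z → z *ℤ sgn s *ℤ Q e l) (β-trinomial s′ s (e + suc μ)) ⟨
        β s′ (s + (e + suc μ)) *ℤ β s (e + suc μ) *ℤ sgn s *ℤ Q e l
          ≡⟨ cong (λ n → β s′ n *ℤ β s (e + suc μ) *ℤ sgn s *ℤ Q e l) (ℕP.+-assoc s e (suc μ)) ⟨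
        β s′ (s + e + suc μ) *ℤ β s (e + suc μ) *ℤ sgn s *ℤ Q e l
          ≡⟨ rearrange (β s′ (s + e + suc μ)) (β s (e + suc μ)) (sgn s) (Q e l) ⟩
        β s′ (s + e + suc μ) *ℤ (sgn s *ℤ β s (e + suc μ) *ℤ Q e l) ∎

    select : ∀ k l → k + l ≡ a →
      conv d (λ s′ x → [ s′ ≡ k ]ℤ *ℤ (β s′ (x + suc μ) *ℤ S x l)) ≡
      + 1 *ℤ β k (l + (δ + suc μ)) *ℤ S (δ + l) l
    select k l refl = begin
      conv (δ + (k + l)) F
        ≡⟨ cong (λ n → conv n F) (shuffle δ k l) ⟩
      conv (k + (δ + l)) F
        ≡⟨ conv-selectˡ k (δ + l) (λ s′ x → β s′ (x + suc μ) *ℤ S x l) ⟩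
      β k (δ + l + suc μ) *ℤ S (δ + l) l
        ≡⟨ cong (_*ℤ S (δ + l) l) (trans (cong (β k) (swap δ l (suc μ))) (sym (ℤP.*-identityˡ _))) ⟩
      + 1 *ℤ β k (l + (δ + suc μ)) *ℤ S (δ + l) l ∎
      where
      F : ℕ → ℕ → ℤ
      F s′ x = [ s′ ≡ k ]ℤ *ℤ (β s′ (x + suc μ) *ℤ S x l)
      shuffle : ∀ δ k l → δ + (k + l) ≡ k + (δ + l)
      shuffle = ℕSolver.solve-∀
      swap : ∀ δ l m → δ + l + m ≡ l + (δ + m)
      swap = ℕSolver.solve-∀

  -- Only `Q e` with e ≤ d enter `S d`, and the degree bound kills each of them at t^i.
  S-low : ∀ d i → d ≤ i + i → S d i ≡ + 0
  S-low d i d≤2i = conv-0 d (λ k e k+e≡d →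
    trans (cong (sgn k *ℤ β k (e + suc μ) *ℤ_)
             (degree e i (ℕP.≤-trans (subst (e ≤_) k+e≡d (ℕP.m≤n+m e k)) d≤2i)))
          (ℤP.*-zeroʳ (sgn k *ℤ β k (e + suc μ))))

  -- Inversion along the diagonal of fixed δ, where the offset is δ + m. The first part of
  -- `uniformPoly` yields an alternating partial sum, and the correction, supported at l = 0, yields
  -- a single term.
  S-high : ∀ δ i → i < δ → S (δ + i) i ≡
    sgn δ *ℤ sgn i *ℤ (β i (δ + suc μ) *ℤ β δ μ - β δ (i + suc μ) *ℤ β i μ)
  S-high δ i i<δ = begin
    S (δ + i) i
      ≡⟨ binomial-inversion (δ + suc μ) sgn (λ _ → + 1) (λ l → S (δ + l) l) (λ l → - uniformPoly μ δ l)
           (λ x → trans (conv-cong x (λ k p _ → cong (_*ℤ β k p) (ℤP.*-identityʳ (sgn k)))) (alternating-sum x))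
           i transform ⟨
    conv i (λ k l → sgn k *ℤ β k (l + (δ + suc μ)) *ℤ (- uniformPoly μ δ l))
      ≡⟨ conv-cong i split ⟩
    conv i (λ k l → - (sgn δ *ℤ β δ (i + suc μ)) *ℤ (sgn k *ℤ β k (l + suc μ)) +ℤ
                    [ l ≡ 0 ]ℤ *ℤ (sgn δ *ℤ sgn k *ℤ β k (l + (δ + suc μ)) *ℤ β δ μ))
      ≡⟨ conv-+ i _ _ ⟩
    conv i (λ k l → - (sgn δ *ℤ β δ (i + suc μ)) *ℤ (sgn k *ℤ β k (l + suc μ))) +ℤ
    conv i (λ k l → [ l ≡ 0 ]ℤ *ℤ (sgn δ *ℤ sgn k *ℤ β k (l + (δ + suc μ)) *ℤ β δ μ))
      ≡⟨ cong₂ _+ℤ_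
           (trans (conv-*ˡ i (- (sgn δ *ℤ β δ (i + suc μ))) _)
                  (cong (- (sgn δ *ℤ β δ (i + suc μ)) *ℤ_) (alternating-partial-sum i μ)))
           (trans (cong (λ n → conv n G) (sym (ℕP.+-identityʳ i)))
                  (conv-selectʳ i 0 (λ k l → sgn δ *ℤ sgn k *ℤ β k (l + (δ + suc μ)) *ℤ β δ μ))) ⟩
    - (sgn δ *ℤ β δ (i + suc μ)) *ℤ (sgn i *ℤ β i μ) +ℤ sgn δ *ℤ sgn i *ℤ β i (δ + suc μ) *ℤ β δ μ
      ≡⟨ collect (sgn δ) (sgn i) (β δ (i + suc μ)) (β i μ) (β i (δ + suc μ)) (β δ μ) ⟩
    sgn δ *ℤ sgn i *ℤ (β i (δ + suc μ) *ℤ β δ μ - β δ (i + suc μ) *ℤ β i μ) ∎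
    where
    G : ℕ → ℕ → ℤ
    G k l = [ l ≡ 0 ]ℤ *ℤ (sgn δ *ℤ sgn k *ℤ β k (l + (δ + suc μ)) *ℤ β δ μ)

    collect : ∀ s t a b c d → - (s *ℤ a) *ℤ (t *ℤ b) +ℤ s *ℤ t *ℤ c *ℤ d ≡ s *ℤ t *ℤ (c *ℤ d - a *ℤ b)
    collect = solve-∀

    -- Since l ≤ δ, the degree bound makes the coefficient of t^δ in `Q (δ + l)` zero, so the
    -- recursion there becomes a linear relation among the values of `S` on the diagonal.
    transform : ∀ l → l ≤ i → - uniformPoly μ δ l ≡ conv l (λ k p → + 1 *ℤ β k (p + (δ + suc μ)) *ℤ S (δ + p) p)
    transform l l≤i = sym (ℤG.inverseʳ-unique (uniformPoly μ δ l) _ (begin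
      uniformPoly μ δ l +ℤ conv l (λ k p → + 1 *ℤ β k (p + (δ + suc μ)) *ℤ S (δ + p) p)
        ≡⟨ cong (uniformPoly μ δ l +ℤ_) (regroup δ l) ⟨
      uniformPoly μ δ l +ℤ conv (δ + l) (λ j e → β j (e + suc μ) *ℤ (boolPoly j *P Q e) l)
        ≡⟨ recursion δ l (ℕP.≤-<-trans z≤n i<δ) ⟨
      Q (δ + l) δ
        ≡⟨ degree (δ + l) δ (ℕP.+-monoʳ-≤ δ (ℕP.≤-trans l≤i (ℕP.<⇒≤ i<δ))) ⟩
      + 0 ∎))

    split : ∀ k l → k + l ≡ i →
      sgn k *ℤ β k (l + (δ + suc μ)) *ℤ (- uniformPoly μ δ l) ≡
      - (sgn δ *ℤ β δ (i + suc μ)) *ℤ (sgn k *ℤ β k (l + suc μ)) +ℤ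
      [ l ≡ 0 ]ℤ *ℤ (sgn δ *ℤ sgn k *ℤ β k (l + (δ + suc μ)) *ℤ β δ μ)
    split k l refl = begin
      sgn k *ℤ β k (l + (δ + suc μ)) *ℤ (- (sgn δ *ℤ (β δ (l + suc μ) - [ l ≡ 0 ]ℤ *ℤ β δ μ)))
        ≡⟨ distribute (sgn k) (β k (l + (δ + suc μ))) (sgn δ) (β δ (l + suc μ)) [ l ≡ 0 ]ℤ (β δ μ) ⟩
      - (sgn δ *ℤ sgn k) *ℤ (β k (l + (δ + suc μ)) *ℤ β δ (l + suc μ)) +ℤ R
        ≡⟨ cong (λ n → - (sgn δ *ℤ sgn k) *ℤ (β k n *ℤ β δ (l + suc μ)) +ℤ R) (swap l δ (suc μ)) ⟩
      - (sgn δ *ℤ sgn k) *ℤ (β k (δ + (l + suc μ)) *ℤ β δ (l + suc μ)) +ℤ R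
        ≡⟨ cong (λ z → - (sgn δ *ℤ sgn k) *ℤ z +ℤ R) (β-exchange k δ (l + suc μ)) ⟩
      - (sgn δ *ℤ sgn k) *ℤ (β δ (k + (l + suc μ)) *ℤ β k (l + suc μ)) +ℤ R
        ≡⟨ cong (λ n → - (sgn δ *ℤ sgn k) *ℤ (β δ n *ℤ β k (l + suc μ)) +ℤ R) (ℕP.+-assoc k l (suc μ)) ⟨
      - (sgn δ *ℤ sgn k) *ℤ (β δ (k + l + suc μ) *ℤ β k (l + suc μ)) +ℤ R
        ≡⟨ cong (_+ℤ R) (rearrange (sgn δ) (sgn k) (β δ (k + l + suc μ)) (β k (l + suc μ))) ⟩
      - (sgn δ *ℤ β δ (k + l + suc μ)) *ℤ (sgn k *ℤ β k (l + suc μ)) +ℤ R ∎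
      where
      R = [ l ≡ 0 ]ℤ *ℤ (sgn δ *ℤ sgn k *ℤ β k (l + (δ + suc μ)) *ℤ β δ μ)
      distribute : ∀ a b c d e f →
        a *ℤ b *ℤ (- (c *ℤ (d - e *ℤ f))) ≡ - (c *ℤ a) *ℤ (b *ℤ d) +ℤ e *ℤ (c *ℤ a *ℤ b *ℤ f)
      distribute = solve-∀
      rearrange : ∀ s t a b → - (s *ℤ t) *ℤ (a *ℤ b) ≡ - (s *ℤ a) *ℤ (t *ℤ b)
      rearrange = solve-∀
      swap : ∀ l δ m → l + (δ + m) ≡ δ + (l + m)
      swap = ℕSolver.solve-∀

  -- The alternating binomial transform is undone by the same transform without signs.
  Q-from-S : ∀ d i → Q d i ≡ conv d (λ k e → β k (e + suc μ) *ℤ S e i)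
  Q-from-S d i = begin
    Q d i
      ≡⟨ binomial-inversion (suc μ) (λ _ → + 1) sgn (λ e → Q e i) (λ e → S e i)
           (λ x → trans (conv-cong x (λ k p _ → cong (_*ℤ β k p) (ℤP.*-identityˡ (sgn p)))) (alternating-sumʳ x))
           d (λ _ _ → refl) ⟨
    conv d (λ k e → + 1 *ℤ β k (e + suc μ) *ℤ S e i)
      ≡⟨ conv-cong d (λ k e _ → cong (_*ℤ S e i) (ℤP.*-identityˡ (β k (e + suc μ)))) ⟩
    conv d (λ k e → β k (e + suc μ) *ℤ S e i) ∎

  -- With d = r + 2i + 1, `S-low` removes every term with e ≤ 2i from the inverse transform. On the
  -- rest `S-high` has two parts: one sums by `alternating-partial-sum`, the other is `altSum` after
  -- C(d+m, i) is taken out.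
  Q-closed : ∀ r i → Q (r + suc (i + i)) i ≡
    β (r + suc i) (i + suc μ) *ℤ β i μ *ℤ β r i - β i (r + suc i + suc μ) *ℤ altSum μ (suc r) i
  Q-closed r i = begin
    Q (r + suc (i + i)) i
      ≡⟨ Q-from-S (r + suc (i + i)) i ⟩
    conv (r + suc (i + i)) (λ k e → β k (e + suc μ) *ℤ S e i)
      ≡⟨ conv-split r (i + i) (λ k e → β k (e + suc μ) *ℤ S e i) ⟩
    conv r (λ k l → β k (l + suc (i + i) + suc μ) *ℤ S (l + suc (i + i)) i) +ℤ
    conv (i + i) (λ k l → β (suc r + k) (l + suc μ) *ℤ S l i)
      ≡⟨ cong₂ _+ℤ_ (conv-cong r main) (conv-0 (i + i) (λ k l k+l≡2i →
           trans (cong (β (suc r + k) (l + suc μ) *ℤ_) (S-low l i (subst (l ≤_) k+l≡2i (ℕP.m≤n+m l k))))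
                 (ℤP.*-zeroʳ (β (suc r + k) (l + suc μ))))) ⟩
    conv r (λ k l → A *ℤ (sgn r *ℤ (sgn k *ℤ β k (l + suc i))) +ℤ (- B) *ℤ t k l) +ℤ + 0
      ≡⟨ ℤP.+-identityʳ _ ⟩
    conv r (λ k l → A *ℤ (sgn r *ℤ (sgn k *ℤ β k (l + suc i))) +ℤ (- B) *ℤ t k l)
      ≡⟨ conv-+ r _ _ ⟩
    conv r (λ k l → A *ℤ (sgn r *ℤ (sgn k *ℤ β k (l + suc i)))) +ℤ conv r (λ k l → (- B) *ℤ t k l)
      ≡⟨ cong₂ _+ℤ_ evaluate (conv-*ˡ r (- B) t) ⟩
    A *ℤ β r i +ℤ (- B) *ℤ conv r t
      ≡⟨ cong (A *ℤ β r i +ℤ_) (sym (ℤP.neg-distribˡ-* B (conv r t))) ⟩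
    A *ℤ β r i - B *ℤ conv r t ∎
    where
    A = β (r + suc i) (i + suc μ) *ℤ β i μ
    B = β i (r + suc i + suc μ)
    t : ℕ → ℕ → ℤ
    t k l = sgn l *ℤ (β k (l + suc i + suc μ) *ℤ β (l + suc i) μ)

    evaluate : conv r (λ k l → A *ℤ (sgn r *ℤ (sgn k *ℤ β k (l + suc i)))) ≡ A *ℤ β r i
    evaluate = begin
      conv r (λ k l → A *ℤ (sgn r *ℤ (sgn k *ℤ β k (l + suc i))))
        ≡⟨ trans (conv-*ˡ r A _) (cong (A *ℤ_) (conv-*ˡ r (sgn r) _)) ⟩
      A *ℤ (sgn r *ℤ conv r (λ k l → sgn k *ℤ β k (l + suc i)))
        ≡⟨ cong (λ z → A *ℤ (sgn r *ℤ z)) (alternating-partial-sum r i) ⟩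
      A *ℤ (sgn r *ℤ (sgn r *ℤ β r i))
        ≡⟨ cong (A *ℤ_) (ℤP.*-assoc (sgn r) (sgn r) (β r i)) ⟨
      A *ℤ (sgn r *ℤ sgn r *ℤ β r i)
        ≡⟨ cong (λ z → A *ℤ (z *ℤ β r i)) (sgn-sq r) ⟩
      A *ℤ (+ 1 *ℤ β r i)
        ≡⟨ cong (A *ℤ_) (ℤP.*-identityˡ (β r i)) ⟩
      A *ℤ β r i ∎

    main : ∀ k l → k + l ≡ r →
      β k (l + suc (i + i) + suc μ) *ℤ S (l + suc (i + i)) i ≡
      A *ℤ (sgn r *ℤ (sgn k *ℤ β k (l + suc i))) +ℤ (- B) *ℤ t k l
    main k l refl = begin
      β k (l + suc (i + i) + suc μ) *ℤ S (l + suc (i + i)) i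
        ≡⟨ cong (λ n → β k (n + suc μ) *ℤ S n i) (ℕP.+-assoc l (suc i) i) ⟨
      β k (δ + i + suc μ) *ℤ S (δ + i) i
        ≡⟨ cong (β k (δ + i + suc μ) *ℤ_) (S-high δ i (ℕP.m≤n+m (suc i) l)) ⟩
      β k (δ + i + suc μ) *ℤ (sgn δ *ℤ sgn i *ℤ (β i (δ + suc μ) *ℤ β δ μ - β δ (i + suc μ) *ℤ β i μ))
        ≡⟨ cong (λ s → β k (δ + i + suc μ) *ℤ (s *ℤ (β i (δ + suc μ) *ℤ β δ μ - β δ (i + suc μ) *ℤ β i μ))) sign-l ⟩
      β k (δ + i + suc μ) *ℤ (- sgn l *ℤ (β i (δ + suc μ) *ℤ β δ μ - β δ (i + suc μ) *ℤ β i μ))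
        ≡⟨ distribute (β k (δ + i + suc μ)) (sgn l) (β i (δ + suc μ)) (β δ μ) (β δ (i + suc μ)) (β i μ) ⟩
      β k (δ + i + suc μ) *ℤ β δ (i + suc μ) *ℤ β i μ *ℤ sgn l +ℤ - (β k (δ + i + suc μ) *ℤ β i (δ + suc μ)) *ℤ (sgn l *ℤ β δ μ)
        ≡⟨ cong₂ (λ u v → u *ℤ β i μ *ℤ sgn l +ℤ - v *ℤ (sgn l *ℤ β δ μ)) tri₁ tri₂ ⟩
      β (k + l + suc i) (i + suc μ) *ℤ β k δ *ℤ β i μ *ℤ sgn l +ℤ
        - (β i (k + l + suc i + suc μ) *ℤ β k (δ + suc μ)) *ℤ (sgn l *ℤ β δ μ)
        ≡⟨ cong (λ s → β (k + l + suc i) (i + suc μ) *ℤ β k δ *ℤ β i μ *ℤ s +ℤ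
             - (β i (k + l + suc i + suc μ) *ℤ β k (δ + suc μ)) *ℤ (sgn l *ℤ β δ μ)) sign-k ⟩
      β (k + l + suc i) (i + suc μ) *ℤ β k δ *ℤ β i μ *ℤ (sgn (k + l) *ℤ sgn k) +ℤ
        - (β i (k + l + suc i + suc μ) *ℤ β k (δ + suc μ)) *ℤ (sgn l *ℤ β δ μ)
        ≡⟨ rearrange (β (k + l + suc i) (i + suc μ)) (β k δ) (β i μ) (sgn (k + l)) (sgn k)
             (β i (k + l + suc i + suc μ)) (β k (δ + suc μ)) (sgn l) (β δ μ) ⟩
      A *ℤ (sgn (k + l) *ℤ (sgn k *ℤ β k δ)) +ℤ (- B) *ℤ t k l ∎
      where
      -- With e = l + 2i + 1 the index δ = e - i exceeds i, as `S-high` requires.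
      δ = l + suc i
      sign-l : sgn δ *ℤ sgn i ≡ - sgn l
      sign-l = begin
        sgn (l + suc i) *ℤ sgn i            ≡⟨ cong (_*ℤ sgn i) (trans (sgn-+ l (suc i)) (cong (sgn l *ℤ_) (sgn-suc i))) ⟩
        sgn l *ℤ (- sgn i) *ℤ sgn i         ≡⟨ move (sgn l) (sgn i) ⟩
        - sgn l *ℤ (sgn i *ℤ sgn i)         ≡⟨ cong (- sgn l *ℤ_) (sgn-sq i) ⟩
        - sgn l *ℤ + 1                      ≡⟨ ℤP.*-identityʳ _ ⟩
        - sgn l ∎
        where
        move : ∀ s t → s *ℤ (- t) *ℤ t ≡ - s *ℤ (t *ℤ t)
        move = solve-∀
      sign-k : sgn l ≡ sgn (k + l) *ℤ sgn k
      sign-k = begin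
        sgn l                          ≡⟨ ℤP.*-identityʳ _ ⟨
        sgn l *ℤ + 1                   ≡⟨ cong (sgn l *ℤ_) (sgn-sq k) ⟨
        sgn l *ℤ (sgn k *ℤ sgn k)      ≡⟨ move (sgn k) (sgn l) ⟩
        sgn k *ℤ sgn l *ℤ sgn k        ≡⟨ cong (_*ℤ sgn k) (sgn-+ k l) ⟨
        sgn (k + l) *ℤ sgn k ∎
        where
        move : ∀ s t → t *ℤ (s *ℤ s) ≡ s *ℤ t *ℤ s
        move = solve-∀
      tri₁ : β k (δ + i + suc μ) *ℤ β δ (i + suc μ) ≡ β (k + l + suc i) (i + suc μ) *ℤ β k δ
      tri₁ = begin
        β k (δ + i + suc μ) *ℤ β δ (i + suc μ)      ≡⟨ cong (λ n → β k n *ℤ β δ (i + suc μ)) (ℕP.+-assoc δ i (suc μ)) ⟩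
        β k (δ + (i + suc μ)) *ℤ β δ (i + suc μ)    ≡⟨ β-trinomial k δ (i + suc μ) ⟩
        β (k + δ) (i + suc μ) *ℤ β k δ            ≡⟨ cong (λ n → β n (i + suc μ) *ℤ β k δ) (ℕP.+-assoc k l (suc i)) ⟨
        β (k + l + suc i) (i + suc μ) *ℤ β k δ ∎
      tri₂ : β k (δ + i + suc μ) *ℤ β i (δ + suc μ) ≡ β i (k + l + suc i + suc μ) *ℤ β k (δ + suc μ)
      tri₂ = begin
        β k (δ + i + suc μ) *ℤ β i (δ + suc μ)      ≡⟨ cong (λ n → β k n *ℤ β i (δ + suc μ)) (swap δ i (suc μ)) ⟩
        β k (i + (δ + suc μ)) *ℤ β i (δ + suc μ)    ≡⟨ β-exchange k i (δ + suc μ) ⟩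
        β i (k + (δ + suc μ)) *ℤ β k (δ + suc μ)    ≡⟨ cong (λ n → β i n *ℤ β k (δ + suc μ)) (reassoc k l (suc i) (suc μ)) ⟩
        β i (k + l + suc i + suc μ) *ℤ β k (δ + suc μ) ∎
        where
        swap : ∀ δ i m → δ + i + m ≡ i + (δ + m)
        swap = ℕSolver.solve-∀
        reassoc : ∀ k l j m → k + (l + j + m) ≡ k + l + j + m
        reassoc = ℕSolver.solve-∀
      distribute : ∀ x s a b c d →
        x *ℤ (- s *ℤ (a *ℤ b - c *ℤ d)) ≡ x *ℤ c *ℤ d *ℤ s +ℤ - (x *ℤ a) *ℤ (s *ℤ b)
      distribute = solve-∀
      rearrange : ∀ a b c d e f g h i →
        a *ℤ b *ℤ c *ℤ (d *ℤ e) +ℤ - (f *ℤ g) *ℤ (h *ℤ i) ≡ a *ℤ c *ℤ (d *ℤ (e *ℤ b)) +ℤ (- f) *ℤ (h *ℤ (g *ℤ i))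
      rearrange = solve-∀

  -- Multiplying by D = r + 1 + i allows absorption to replace `β r i` by `β (suc r) i`; the
  -- trinomial identity then extracts C(d+m, i) from the first term too, and `reduced` remains.
  Q-formula : ∀ r i → + (suc r + i) *ℤ Q (r + suc (i + i)) i ≡ β i (r + suc i + suc μ) *ℤ rhsSum μ (suc r) i
  Q-formula r i = begin
    + (suc r + i) *ℤ Q (r + suc (i + i)) i
      ≡⟨ cong (+ (suc r + i) *ℤ_) (Q-closed r i) ⟩
    + (suc r + i) *ℤ (β (r + suc i) (i + suc μ) *ℤ β i μ *ℤ β r i - B *ℤ J)
      ≡⟨ distribute (+ (suc r + i)) (β (r + suc i) (i + suc μ)) (β i μ) (β r i) B J ⟩
    β (r + suc i) (i + suc μ) *ℤ β i μ *ℤ (+ (suc r + i) *ℤ β r i) - B *ℤ (+ (suc r + i) *ℤ J)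
      ≡⟨ cong (λ z → β (r + suc i) (i + suc μ) *ℤ β i μ *ℤ z - B *ℤ (+ (suc r + i) *ℤ J)) (β-absorb r i) ⟨
    β (r + suc i) (i + suc μ) *ℤ β i μ *ℤ (+ suc r *ℤ β (suc r) i) - B *ℤ (+ (suc r + i) *ℤ J)
      ≡⟨ cong (_- B *ℤ (+ (suc r + i) *ℤ J)) (pair (β (r + suc i) (i + suc μ)) (β i μ) (+ suc r) (β (suc r) i)) ⟩
    β (r + suc i) (i + suc μ) *ℤ β (suc r) i *ℤ (+ suc r *ℤ β i μ) - B *ℤ (+ (suc r + i) *ℤ J)
      ≡⟨ cong (λ z → z *ℤ (+ suc r *ℤ β i μ) - B *ℤ (+ (suc r + i) *ℤ J)) trinomial ⟩
    B *ℤ β (suc r) (i + suc μ) *ℤ (+ suc r *ℤ β i μ) - B *ℤ (+ (suc r + i) *ℤ J)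
      ≡⟨ factor B (β (suc r) (i + suc μ)) (+ suc r) (β i μ) (+ (suc r + i) *ℤ J) ⟩
    B *ℤ reduced μ (suc r) i
      ≡⟨ cong (B *ℤ_) (reduced≡rhsSum μ (suc r) i) ⟩
    B *ℤ rhsSum μ (suc r) i ∎
    where
    B = β i (r + suc i + suc μ)
    J = altSum μ (suc r) i
    distribute : ∀ x a b c d e → x *ℤ (a *ℤ b *ℤ c - d *ℤ e) ≡ a *ℤ b *ℤ (x *ℤ c) - d *ℤ (x *ℤ e)
    distribute = solve-∀
    pair : ∀ a b c d → a *ℤ b *ℤ (c *ℤ d) ≡ a *ℤ d *ℤ (c *ℤ b)
    pair = solve-∀
    factor : ∀ b x s y z → b *ℤ x *ℤ (s *ℤ y) - b *ℤ z ≡ b *ℤ (s *ℤ (x *ℤ y) - z)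
    factor = solve-∀
    trinomial : β (r + suc i) (i + suc μ) *ℤ β (suc r) i ≡ B *ℤ β (suc r) (i + suc μ)
    trinomial = begin
      β (r + suc i) (i + suc μ) *ℤ β (suc r) i
        ≡⟨ cong₂ (λ n z → β n (i + suc μ) *ℤ z) (shift r i) (β-comm (suc r) i) ⟩
      β (i + suc r) (i + suc μ) *ℤ β i (suc r)
        ≡⟨ β-trinomial i (suc r) (i + suc μ) ⟨
      β i (suc r + (i + suc μ)) *ℤ β (suc r) (i + suc μ)
        ≡⟨ cong (λ n → β i n *ℤ β (suc r) (i + suc μ)) (reassoc r i (suc μ)) ⟩
      B *ℤ β (suc r) (i + suc μ) ∎
      where
      shift : ∀ r i → r + suc i ≡ i + suc r
      shift = ℕSolver.solve-∀
      reassoc : ∀ r i m → suc r + (i + m) ≡ r + suc i + m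
      reassoc = ℕSolver.solve-∀

-- Uniform matroids

if-scale : ∀ b z → (if b then z else + 0) ≡ (if b then + 1 else + 0) *ℤ z
if-scale true  z = sym (ℤP.*-identityˡ z)
if-scale false z = refl

sumℤ-++ : ∀ xs ys → sumℤ (xs ++ ys) ≡ sumℤ xs +ℤ sumℤ ys
sumℤ-++ []       ys = sym (ℤP.+-identityˡ _)
sumℤ-++ (x ∷ xs) ys = trans (cong (x +ℤ_) (sumℤ-++ xs ys)) (sym (ℤP.+-assoc x _ _))

sumℤ-0 : ∀ {A : Set} (xs : List A) → sumℤ (map (λ _ → + 0) xs) ≡ + 0
sumℤ-0 []       = refl
sumℤ-0 (x ∷ xs) = trans (ℤP.+-identityˡ _) (sumℤ-0 xs)

sum-subsets-∷ : ∀ n (f : Subset (suc n) → ℤ) → sumℤ (map f (subsets (suc n))) ≡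
  sumℤ (map (λ F → f (outside ∷ F)) (subsets n)) +ℤ sumℤ (map (λ F → f (inside ∷ F)) (subsets n))
sum-subsets-∷ n f = begin
  sumℤ (map f (map (outside ∷_) (subsets n) ++ map (inside ∷_) (subsets n)))
    ≡⟨ cong sumℤ (map-++ f (map (outside ∷_) (subsets n)) _) ⟩
  sumℤ (map f (map (outside ∷_) (subsets n)) ++ map f (map (inside ∷_) (subsets n)))
    ≡⟨ sumℤ-++ (map f (map (outside ∷_) (subsets n))) _ ⟩
  sumℤ (map f (map (outside ∷_) (subsets n))) +ℤ sumℤ (map f (map (inside ∷_) (subsets n)))
    ≡⟨ cong₂ (λ u v → sumℤ u +ℤ sumℤ v) (map-∘ (subsets n)) (map-∘ (subsets n)) ⟨
  sumℤ (map (λ F → f (outside ∷ F)) (subsets n)) +ℤ sumℤ (map (λ F → f (inside ∷ F)) (subsets n)) ∎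

-- The inductive step for counting subsets: a new element is left out or taken, and Pascal's rule
-- adds the two counts.
conv-pascal : ∀ a (ψ : ℕ → ℕ → ℤ) →
  conv a (λ j j′ → β j j′ *ℤ ψ j (suc j′)) +ℤ conv a (λ j j′ → β j j′ *ℤ ψ (suc j) j′)
    ≡ conv (suc a) (λ j j′ → β j j′ *ℤ ψ j j′)
conv-pascal zero    ψ = refl
conv-pascal (suc b) ψ = begin
  β 0 (suc b) *ℤ ψ 0 (suc (suc b)) +ℤ conv b (λ k l → β (suc k) l *ℤ ψ (suc k) (suc l))
    +ℤ conv (suc b) (λ j j′ → β j j′ *ℤ ψ (suc j) j′)
    ≡⟨ cong (x +ℤ u +ℤ_) (conv-last b (λ j j′ → β j j′ *ℤ ψ (suc j) j′)) ⟩
  x +ℤ u +ℤ (v +ℤ β (suc b) 0 *ℤ ψ (suc (suc b)) 0)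
    ≡⟨ rearrange x u v _ ⟩
  x +ℤ (v +ℤ u +ℤ β (suc b) 0 *ℤ ψ (suc (suc b)) 0)
    ≡⟨ cong₂ (λ p q → x +ℤ (p +ℤ q *ℤ ψ (suc (suc b)) 0)) (sym (conv-+ b _ _))
         (trans (β-0ʳ (suc b)) (sym (β-0ʳ (suc (suc b))))) ⟩
  x +ℤ (conv b (λ k l → β k (suc l) *ℤ ψ (suc k) (suc l) +ℤ β (suc k) l *ℤ ψ (suc k) (suc l)) +ℤ y)
    ≡⟨ cong (λ p → x +ℤ (p +ℤ y)) (conv-cong b (λ k l _ →
         trans (sym (ℤP.*-distribʳ-+ (ψ (suc k) (suc l)) (β k (suc l)) (β (suc k) l)))
               (cong (_*ℤ ψ (suc k) (suc l)) (sym (β-pascal k l))))) ⟩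
  x +ℤ (conv b (λ k l → β (suc k) (suc l) *ℤ ψ (suc k) (suc l)) +ℤ y)
    ≡⟨ cong (x +ℤ_) (conv-last b (λ k l → β (suc k) l *ℤ ψ (suc k) l)) ⟨
  conv (suc (suc b)) (λ j j′ → β j j′ *ℤ ψ j j′) ∎
  where
  x = β 0 (suc b) *ℤ ψ 0 (suc (suc b))
  u = conv b (λ k l → β (suc k) l *ℤ ψ (suc k) (suc l))
  v = conv b (λ k l → β k (suc l) *ℤ ψ (suc k) (suc l))
  y = β (suc (suc b)) 0 *ℤ ψ (suc (suc b)) 0
  rearrange : ∀ x u v y → x +ℤ u +ℤ (v +ℤ y) ≡ x +ℤ (v +ℤ u +ℤ y)
  rearrange = solve-∀

-- Sorts the subsets of `G` by size, `β j j′` being the number with j elements and j′ left over. The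
-- assumption concerns subsets of `G` only and is given j′, so that rank and flatness can be read
-- from the sizes.
sum-over-subsets : ∀ {n} (G : Subset n) (φ : Subset n → ℤ) (ψ : ℕ → ℕ → ℤ) →
  (∀ F → F ⊆ᵇ G ≡ true → ∀ j′ → size F + j′ ≡ size G → φ F ≡ ψ (size F) j′) →
  sumℤ (map (λ F → if F ⊆ᵇ G then φ F else + 0) (subsets n)) ≡ conv (size G) (λ j j′ → β j j′ *ℤ ψ j j′)
sum-over-subsets [] φ ψ eq = begin
  φ [] +ℤ + 0      ≡⟨ ℤP.+-identityʳ _ ⟩
  φ []             ≡⟨ eq [] refl 0 refl ⟩
  ψ 0 0            ≡⟨ ℤP.*-identityˡ _ ⟨
  + 1 *ℤ ψ 0 0 ∎
sum-over-subsets {suc n} (false ∷ G) φ ψ eq = begin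
  sumℤ (map (λ F → if F ⊆ᵇ (false ∷ G) then φ F else + 0) (subsets (suc n)))
    ≡⟨ sum-subsets-∷ n (λ F → if F ⊆ᵇ (false ∷ G) then φ F else + 0) ⟩
  sumℤ (map (λ F → if F ⊆ᵇ G then φ (false ∷ F) else + 0) (subsets n)) +ℤ sumℤ (map (λ _ → + 0) (subsets n))
    ≡⟨ cong₂ _+ℤ_ (sum-over-subsets G (λ F → φ (false ∷ F)) ψ (λ F → eq (false ∷ F))) (sumℤ-0 (subsets n)) ⟩
  conv (size G) (λ j j′ → β j j′ *ℤ ψ j j′) +ℤ + 0
    ≡⟨ ℤP.+-identityʳ _ ⟩
  conv (size G) (λ j j′ → β j j′ *ℤ ψ j j′) ∎
sum-over-subsets {suc n} (true ∷ G) φ ψ eq = begin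
  sumℤ (map (λ F → if F ⊆ᵇ (true ∷ G) then φ F else + 0) (subsets (suc n)))
    ≡⟨ sum-subsets-∷ n (λ F → if F ⊆ᵇ (true ∷ G) then φ F else + 0) ⟩
  sumℤ (map (λ F → if F ⊆ᵇ G then φ (false ∷ F) else + 0) (subsets n)) +ℤ
  sumℤ (map (λ F → if F ⊆ᵇ G then φ (true ∷ F) else + 0) (subsets n))
    ≡⟨ cong₂ _+ℤ_
         (sum-over-subsets G (λ F → φ (false ∷ F)) (λ j j′ → ψ j (suc j′))
            (λ F F⊆G j′ p → eq (false ∷ F) F⊆G (suc j′) (trans (ℕP.+-suc (size F) j′) (cong suc p))))
         (sum-over-subsets G (λ F → φ (true ∷ F)) (λ j j′ → ψ (suc j) j′)
            (λ F F⊆G j′ p → eq (true ∷ F) F⊆G j′ (cong suc p))) ⟩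
  conv (size G) (λ j j′ → β j j′ *ℤ ψ j (suc j′)) +ℤ conv (size G) (λ j j′ → β j j′ *ℤ ψ (suc j) j′)
    ≡⟨ conv-pascal (size G) ψ ⟩
  conv (suc (size G)) (λ j j′ → β j j′ *ℤ ψ j j′) ∎

-- Cardinalities of subsets

⊆ᵇ-sound : ∀ {n} (F G : Subset n) → F ⊆ᵇ G ≡ true → F ⊆ G
⊆ᵇ-sound (true  ∷ F) (true ∷ G) p = SP.in⊆in (⊆ᵇ-sound F G p)
⊆ᵇ-sound (false ∷ F) (y ∷ G)    p = SP.out⊆ (⊆ᵇ-sound F G p)
⊆ᵇ-sound []          []         p = λ ()

∣∪∣+∣∩∣ : ∀ {n} (S T : Subset n) → size (S ∪ T) + size (S ∩ T) ≡ size S + size T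
∣∪∣+∣∩∣ []          []          = refl
∣∪∣+∣∩∣ (true  ∷ S) (true  ∷ T) = cong suc (trans (ℕP.+-suc _ _) (trans (cong suc (∣∪∣+∣∩∣ S T)) (sym (ℕP.+-suc _ _))))
∣∪∣+∣∩∣ (true  ∷ S) (false ∷ T) = cong suc (∣∪∣+∣∩∣ S T)
∣∪∣+∣∩∣ (false ∷ S) (true  ∷ T) = trans (cong suc (∣∪∣+∣∩∣ S T)) (sym (ℕP.+-suc _ _))
∣∪∣+∣∩∣ (false ∷ S) (false ∷ T) = ∣∪∣+∣∩∣ S T

∣disjoint-∪∣ : ∀ {n} (S T : Subset n) → (∀ {x} → x ∈ S → x ∉ T) → size (S ∪ T) ≡ size S + size T
∣disjoint-∪∣ {n} S T disjoint = begin
  size (S ∪ T)                    ≡⟨ ℕP.+-identityʳ _ ⟨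
  size (S ∪ T) + 0                ≡⟨ cong (λ c → size (S ∪ T) + c) (trans (cong size S∩T≡⊥) (SP.∣⊥∣≡0 n)) ⟨
  size (S ∪ T) + size (S ∩ T)        ≡⟨ ∣∪∣+∣∩∣ S T ⟩
  size S + size T ∎
  where
  S∩T≡⊥ : S ∩ T ≡ ⊥
  S∩T≡⊥ = SP.Empty-unique (λ (x , x∈S∩T) → let (x∈S , x∈T) = SP.x∈p∩q⁻ S T x∈S∩T in disjoint x∈S x∈T)

∣complement∣ : ∀ {n} (F G : Subset n) → F ⊆ᵇ G ≡ true → size F + size (G ∩ ∁ F) ≡ size G
∣complement∣ []          []          p = refl
∣complement∣ (true  ∷ F) (true  ∷ G) p = cong suc (∣complement∣ F G p)
∣complement∣ (false ∷ F) (true  ∷ G) p = trans (ℕP.+-suc _ _) (cong suc (∣complement∣ F G p))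
∣complement∣ (false ∷ F) (false ∷ G) p = ∣complement∣ F G p

⊆∧∣≡∣⇒≡ : ∀ {n} (F G : Subset n) → F ⊆ᵇ G ≡ true → size F ≡ size G → F ≡ G
⊆∧∣≡∣⇒≡ []          []          p q = refl
⊆∧∣≡∣⇒≡ (true  ∷ F) (true  ∷ G) p q = cong (true ∷_) (⊆∧∣≡∣⇒≡ F G p (ℕP.suc-injective q))
⊆∧∣≡∣⇒≡ (false ∷ F) (true  ∷ G) p q = ⊥-elim (ℕP.<-irrefl q (s≤s (SP.p⊆q⇒∣p∣≤∣q∣ (⊆ᵇ-sound F G p))))
⊆∧∣≡∣⇒≡ (false ∷ F) (false ∷ G) p q = cong (false ∷_) (⊆∧∣≡∣⇒≡ F G p q)

∣<∣⇒∃∉ : ∀ {n} (F G : Subset n) → F ⊆ᵇ G ≡ true → size F < size G →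
  ∃ λ x → lookup G x ≡ true × lookup F x ≡ false
∣<∣⇒∃∉ (true  ∷ F) (true  ∷ G) p (s≤s q) = let (x , r) = ∣<∣⇒∃∉ F G p q in Fin.suc x , r
∣<∣⇒∃∉ (false ∷ F) (true  ∷ G) p q = Fin.zero , refl , refl
∣<∣⇒∃∉ (false ∷ F) (false ∷ G) p q = let (x , r) = ∣<∣⇒∃∉ F G p q in Fin.suc x , r

∪-lub : ∀ {n} {S T G : Subset n} → S ⊆ G → T ⊆ G → S ∪ T ⊆ G
∪-lub {S = S} {T} S⊆G T⊆G x∈S∪T = [ S⊆G , T⊆G ]′ (SP.x∈p∪q⁻ S T x∈S∪T)

singleton-⊆ : ∀ {n} {x : Fin n} {G : Subset n} → x ∈ G → ⁅ x ⁆ ⊆ G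
singleton-⊆ {x = x} {G} x∈G y∈⁅x⁆ = subst (_∈ G) (sym (SP.x∈⁅y⁆⇒x≡y x y∈⁅x⁆)) x∈G

∣∪⁅⁆∣ : ∀ {n} (F : Subset n) x → lookup F x ≡ false → size (F ∪ ⁅ x ⁆) ≡ suc (size F)
∣∪⁅⁆∣ F x x∉F = begin
  size (F ∪ ⁅ x ⁆)        ≡⟨ ∣disjoint-∪∣ F ⁅ x ⁆ disjoint ⟩
  size F + size ⁅ x ⁆    ≡⟨ cong (λ c → size F + c) (SP.∣⁅x⁆∣≡1 x) ⟩
  size F + 1            ≡⟨ ℕP.+-comm (size F) 1 ⟩
  suc (size F) ∎
  where
  disjoint : ∀ {y} → y ∈ F → y ∉ ⁅ x ⁆
  disjoint y∈F y∈⁅x⁆ with SP.x∈⁅y⁆⇒x≡y x y∈⁅x⁆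
  ... | refl with trans (sym x∉F) ([]=⇒lookup y∈F)
  ...   | ()

-- If c or e reaches d, its truncation dominates that of a, and b lies below the other one.
-- Otherwise c and e are not truncated and the given equality suffices.
⊓-submodular : ∀ {a b c e} d → a + b ≡ c + e → b ≤ c → b ≤ e → a ⊓ d + b ⊓ d ≤ c ⊓ d + e ⊓ d
⊓-submodular {a} {b} {c} {e} d eq b≤c b≤e with ℕP.≤-total c d | ℕP.≤-total e d
... | inj₂ d≤c | _ = ℕP.+-mono-≤ (ℕP.≤-trans (ℕP.m⊓n≤n a d) (ℕP.≤-reflexive (sym (ℕP.m≥n⇒m⊓n≡n d≤c)))) (ℕP.⊓-monoˡ-≤ d b≤e)
... | inj₁ _ | inj₂ d≤e = ℕP.≤-trans
  (ℕP.+-mono-≤ (ℕP.≤-trans (ℕP.m⊓n≤n a d) (ℕP.≤-reflexive (sym (ℕP.m≥n⇒m⊓n≡n d≤e)))) (ℕP.⊓-monoˡ-≤ d b≤c))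
  (ℕP.≤-reflexive (ℕP.+-comm (e ⊓ d) (c ⊓ d)))
... | inj₁ c≤d | inj₁ e≤d = ℕP.≤-trans (ℕP.+-mono-≤ (ℕP.m⊓n≤m a d) (ℕP.m⊓n≤m b d))
  (ℕP.≤-reflexive (trans eq (sym (cong₂ _+_ (ℕP.m≤n⇒m⊓n≡m c≤d) (ℕP.m≤n⇒m⊓n≡m e≤d)))))

-- Uniformity of rank d and corank m on any ground set inside `Fin n`. Contractions of `U m d` live
-- on smaller ground sets, and their rank functions are prescribed only on subsets of those.
record Uniform (m d : ℕ) {n : ℕ} (M : MData n) : Set where
  field
    card    : size (ground M) ≡ d + m
    rk-⊆    : ∀ S → S ⊆ ground M → rk M S ≡ size S ⊓ d

  rank≡d : rank M ≡ d
  rank≡d = trans (rk-⊆ (ground M) (λ x → x)) (ℕP.m≥n⇒m⊓n≡n (subst (d ≤_) (sym card) (ℕP.m≤m+n d m)))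

open Uniform

U-uniform : ∀ m d → Uniform m d (U m d)
U-uniform m d .card     = trans (SP.∣⊤∣≡n (m + d)) (ℕP.+-comm m d)
U-uniform m d .rk-⊆ S _ = refl

uniform⇒loopless : ∀ {m d n} {M : MData n} → 0 < d → Uniform m d M → IsLooplessMatroid M
uniform⇒loopless {d = d} {M = M} 0<d u = record
  { rk-≤card  = λ S S⊆G → ℕP.≤-trans (ℕP.≤-reflexive (rk-⊆ u S S⊆G)) (ℕP.m⊓n≤m _ _)
  ; rk-mono   = λ S T S⊆T T⊆G → ≤-resp (rk-⊆ u S (λ x → T⊆G (S⊆T x))) (rk-⊆ u T T⊆G)
                  (ℕP.⊓-monoˡ-≤ d (SP.p⊆q⇒∣p∣≤∣q∣ S⊆T))
  ; rk-submod = λ S T S⊆G T⊆G → ≤-resp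
      (cong₂ _+_ (rk-⊆ u (S ∪ T) (∪-lub S⊆G T⊆G)) (rk-⊆ u (S ∩ T) (λ x → S⊆G (SP.p∩q⊆p S T x))))
      (cong₂ _+_ (rk-⊆ u S S⊆G) (rk-⊆ u T T⊆G))
      (⊓-submodular d (∣∪∣+∣∩∣ S T) (SP.∣p∩q∣≤∣p∣ S T) (SP.∣p∩q∣≤∣q∣ S T))
  ; loopless  = λ x x∈G → trans (rk-⊆ u ⁅ x ⁆ (singleton-⊆ x∈G))
                  (trans (cong (_⊓ d) (SP.∣⁅x⁆∣≡1 x)) (ℕP.m≤n⇒m⊓n≡m 0<d))
  }
  where
  ≤-resp : ∀ {a b a′ b′} → a ≡ a′ → b ≡ b′ → a′ ≤ b′ → a ≤ b
  ≤-resp refl refl a≤b = a≤b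

-- `F` is independent, so contracting it lowers the rank and the number of elements equally and m
-- does not change.
contract-uniform : ∀ {m d n} {M : MData n} → Uniform m d M → ∀ F → F ⊆ᵇ ground M ≡ true →
  ∀ e → size F + e ≡ d → Uniform m e (contract M F)
contract-uniform {m} {d} {M = M} u F F⊆G e refl .card =
  ℕP.+-cancelˡ-≡ (size F) _ _ (trans (∣complement∣ F (ground M) F⊆G) (trans (card u) (ℕP.+-assoc (size F) e m)))
contract-uniform {m} {d} {M = M} u F F⊆G e refl .rk-⊆ S S⊆G∖F = begin
  rk M (S ∪ F) ∸ rk M F
    ≡⟨ cong₂ _∸_ (rk-⊆ u (S ∪ F) (∪-lub (λ x → SP.p∩q⊆p (ground M) (∁ F) (S⊆G∖F x)) (⊆ᵇ-sound F _ F⊆G)))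
                 (rk-⊆ u F (⊆ᵇ-sound F _ F⊆G)) ⟩
  size (S ∪ F) ⊓ (size F + e) ∸ size F ⊓ (size F + e)
    ≡⟨ cong₂ (λ a b → a ⊓ (size F + e) ∸ b)
         (trans (∣disjoint-∪∣ S F (λ x∈S → SP.x∈∁p⇒x∉p (SP.p∩q⊆q (ground M) (∁ F) (S⊆G∖F x∈S)))) (ℕP.+-comm (size S) (size F)))
         (ℕP.m≤n⇒m⊓n≡m (ℕP.m≤m+n (size F) e)) ⟩
  (size F + size S) ⊓ (size F + e) ∸ size F
    ≡⟨ cong (_∸ size F) (ℕP.+-distribˡ-⊓ (size F) (size S) e) ⟨
  size F + size S ⊓ e ∸ size F
    ≡⟨ ℕP.m+n∸m≡n (size F) _ ⟩
  size S ⊓ e ∎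

module _ {n : ℕ} (M : MData n) where

  private
    G = ground M

    rk/G≡0 : ∀ S → S ⊆ ground (contract M G) → rk (contract M G) S ≡ 0
    rk/G≡0 S S⊆ = trans (cong (λ T → rk M T ∸ rk M G) S∪G≡G) (ℕP.n∸n≡0 (rk M G))
      where
      S∪G≡G : S ∪ G ≡ G
      S∪G≡G = SP.⊆-antisym (∪-lub (λ x → SP.p∩q⊆p G (∁ G) (S⊆ x)) (λ x → x)) (SP.q⊆p∪q S G)

  contract-ground-rank : rank (contract M G) ≡ 0
  contract-ground-rank = rk/G≡0 (G ∩ ∁ G) (λ x → x)

  -- The ground set of this contraction is empty and all its ranks are 0. The rank-zero clause of
  -- `IsKL` therefore gives it the polynomial 1.
  contract-ground-loopless : IsLooplessMatroid (contract M G)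
  contract-ground-loopless = record
    { rk-≤card  = λ S S⊆ → subst (_≤ size S) (sym (rk/G≡0 S S⊆)) z≤n
    ; rk-mono   = λ S T S⊆T T⊆ → subst (_≤ rk (contract M G) T) (sym (rk/G≡0 S (λ x → T⊆ (S⊆T x)))) z≤n
    ; rk-submod = λ S T S⊆ T⊆ → subst (_≤ rk (contract M G) S + rk (contract M G) T)
        (sym (cong₂ _+_ (rk/G≡0 (S ∪ T) (∪-lub S⊆ T⊆)) (rk/G≡0 (S ∩ T) (λ x → S⊆ (SP.p∩q⊆p S T x))))) z≤n
    ; loopless  = λ x x∈ → ⊥-elim (SP.x∈p⇒x∉∁p (SP.p∩q⊆p G (∁ G) x∈) (SP.p∩q⊆q G (∁ G) x∈))
    }

-- Flats and characteristic polynomials of uniform matroids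

allᵇ-true : ∀ {A : Set} (p : A → Bool) xs → (∀ x → p x ≡ true) → allᵇ p xs ≡ true
allᵇ-true p []       eq = refl
allᵇ-true p (x ∷ xs) eq = cong₂ _∧_ (eq x) (allᵇ-true p xs eq)

allᵇ-false : ∀ {A : Set} (p : A → Bool) {x xs} → x List.∈ xs → p x ≡ false → allᵇ p xs ≡ false
allᵇ-false p {xs = _ ∷ xs} (here refl) eq = cong (_∧ allᵇ p xs) eq
allᵇ-false p {xs = y ∷ ys} (there x∈xs) eq with p y
... | true  = allᵇ-false p x∈xs eq
... | false = refl

≡ᵇ-refl : ∀ n → (n ≡ᵇ n) ≡ true
≡ᵇ-refl zero    = refl
≡ᵇ-refl (suc n) = ≡ᵇ-refl n

suc-≢ᵇ : ∀ n → (suc n ≡ᵇ n) ≡ false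
suc-≢ᵇ zero    = refl
suc-≢ᵇ (suc n) = suc-≢ᵇ n

-- The second conjunct of `isFlat`, named so that the inclusion test can be split off by `if-∧`.
closed : ∀ {n} → MData n → Subset n → Bool
closed {n} M F =
  allᵇ (λ e → if lookup (ground M) e ∧ not (lookup F e) then not (rk M (F ∪ ⁅ e ⁆) ≡ᵇ rk M F) else true) (allFin n)

if-∧-not : ∀ b c {x} → (b ≡ true → c ≡ false → x ≡ true) → (if b ∧ not c then x else true) ≡ true
if-∧-not false c     eq = refl
if-∧-not true  true  eq = refl
if-∧-not true  false eq = eq refl refl

closed-ground : ∀ {n} (M : MData n) → closed M (ground M) ≡ true
closed-ground {n} M = allᵇ-true _ (allFin n) (λ e →
  if-∧-not (lookup (ground M) e) (lookup (ground M) e) (λ t f → contra (trans (sym t) f)))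
  where
  contra : ∀ {b} → true ≡ false → b ≡ true
  contra ()

module _ {m d n : ℕ} {M : MData n} (u : Uniform m d M) (F : Subset n) (F⊆ᵇG : F ⊆ᵇ ground M ≡ true) where

  private
    F⊆G : F ⊆ ground M
    F⊆G = ⊆ᵇ-sound F (ground M) F⊆ᵇG

    rk-∪⁅⁆ : ∀ x → lookup (ground M) x ≡ true → lookup F x ≡ false → rk M (F ∪ ⁅ x ⁆) ≡ suc (size F) ⊓ d
    rk-∪⁅⁆ x x∈G x∉F = trans
      (rk-⊆ u (F ∪ ⁅ x ⁆) (∪-lub F⊆G (singleton-⊆ (lookup⇒[]= x (ground M) x∈G))))
      (cong (_⊓ d) (∣∪⁅⁆∣ F x x∉F))

  closed-small : size F < d → closed M F ≡ true
  closed-small F<d = allᵇ-true _ (allFin n) (λ x →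
    if-∧-not (lookup (ground M) x) (lookup F x) (λ x∈G x∉F → cong not (begin
      (rk M (F ∪ ⁅ x ⁆) ≡ᵇ rk M F)      ≡⟨ cong₂ _≡ᵇ_ (rk-∪⁅⁆ x x∈G x∉F) (rk-⊆ u F F⊆G) ⟩
      (suc (size F) ⊓ d ≡ᵇ size F ⊓ d)      ≡⟨ cong₂ _≡ᵇ_ (ℕP.m≤n⇒m⊓n≡m F<d) (ℕP.m≤n⇒m⊓n≡m (ℕP.<⇒≤ F<d)) ⟩
      (suc (size F) ≡ᵇ size F)              ≡⟨ suc-≢ᵇ (size F) ⟩
      false ∎)))

  -- The rank is already d, so any ground element outside `F` can be added without raising it.
  closed-large : d ≤ size F → size F < size (ground M) → closed M F ≡ false
  closed-large d≤F F<G with ∣<∣⇒∃∉ F (ground M) F⊆ᵇG F<G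
  ... | x , x∈G , x∉F = allᵇ-false _ (∈-allFin x) (begin
    (if lookup (ground M) x ∧ not (lookup F x) then not (rk M (F ∪ ⁅ x ⁆) ≡ᵇ rk M F) else true)
      ≡⟨ cong₂ (λ b c → if b ∧ not c then not (rk M (F ∪ ⁅ x ⁆) ≡ᵇ rk M F) else true) x∈G x∉F ⟩
    not (rk M (F ∪ ⁅ x ⁆) ≡ᵇ rk M F)
      ≡⟨ cong₂ (λ a b → not (a ≡ᵇ b)) (rk-∪⁅⁆ x x∈G x∉F) (rk-⊆ u F F⊆G) ⟩
    not (suc (size F) ⊓ d ≡ᵇ size F ⊓ d)
      ≡⟨ cong₂ (λ a b → not (a ≡ᵇ b)) (ℕP.m≥n⇒m⊓n≡n (ℕP.≤-trans d≤F (ℕP.n≤1+n _))) (ℕP.m≥n⇒m⊓n≡n d≤F) ⟩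
    not (d ≡ᵇ d)
      ≡⟨ cong not (≡ᵇ-refl d) ⟩
    false ∎)

  -- Every subset of `F` is independent, so the restriction is Boolean.
  charPoly-small : size F ≤ d → ∀ k → charPoly (restrict M F) k ≡ boolPoly (size F) k
  charPoly-small F≤d k = begin
    sumℤ (map (λ S → if (S ⊆ᵇ F) ∧ (rk M F ∸ rk M S ≡ᵇ k) then sgn (size S) else + 0) (subsets n))
      ≡⟨ cong sumℤ (map-cong (λ S → if-∧ (S ⊆ᵇ F)) (subsets n)) ⟩
    sumℤ (map (λ S → if S ⊆ᵇ F then (if rk M F ∸ rk M S ≡ᵇ k then sgn (size S) else + 0) else + 0) (subsets n))
      ≡⟨ sum-over-subsets F (λ S → if rk M F ∸ rk M S ≡ᵇ k then sgn (size S) else + 0)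
           (λ s s′ → [ s′ ≡ k ]ℤ *ℤ sgn s) term ⟩
    boolPoly (size F) k ∎
    where
    term : ∀ S → S ⊆ᵇ F ≡ true → ∀ s′ → size S + s′ ≡ size F →
      (if rk M F ∸ rk M S ≡ᵇ k then sgn (size S) else + 0) ≡ [ s′ ≡ k ]ℤ *ℤ sgn (size S)
    term S S⊆F s′ eq = trans (cong (λ j → if j ≡ᵇ k then sgn (size S) else + 0) (begin
      rk M F ∸ rk M S
        ≡⟨ cong₂ _∸_ (rk-⊆ u F F⊆G) (rk-⊆ u S (λ x → F⊆G (⊆ᵇ-sound S F S⊆F x))) ⟩
      size F ⊓ d ∸ size S ⊓ d
        ≡⟨ cong₂ _∸_ (ℕP.m≤n⇒m⊓n≡m F≤d)
             (ℕP.m≤n⇒m⊓n≡m (ℕP.≤-trans (SP.p⊆q⇒∣p∣≤∣q∣ (⊆ᵇ-sound S F S⊆F)) F≤d)) ⟩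
      size F ∸ size S
        ≡⟨ cong (_∸ size S) eq ⟨
      size S + s′ ∸ size S
        ≡⟨ ℕP.m+n∸m≡n (size S) s′ ⟩
      s′ ∎)) (if-scale (s′ ≡ᵇ k) (sgn (size S)))

-- A set of size s ≤ d has corank d - s, so t^a selects s = δ. All larger sets have corank 0 and
-- contribute only when a = 0.
uniformPoly-sum : ∀ μ δ a →
  conv (δ + a + suc μ) (λ s s′ → β s s′ *ℤ (if (δ + a ∸ s ⊓ (δ + a)) ≡ᵇ a then sgn s else + 0)) ≡ uniformPoly μ δ a
uniformPoly-sum μ δ a = begin
  conv (d + suc μ) (λ s s′ → β s s′ *ℤ ψ s)
    ≡⟨ conv-split d μ (λ s s′ → β s s′ *ℤ ψ s) ⟩
  conv d (λ s e → β s (e + suc μ) *ℤ ψ s) +ℤ conv μ (λ k l → β (suc d + k) l *ℤ ψ (suc d + k))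
    ≡⟨ cong₂ _+ℤ_ (trans (conv-cong d low) (conv-selectʳ δ a (λ s e → sgn s *ℤ β s (e + suc μ))))
                  (trans (conv-cong μ (λ k l _ → high k l)) (conv-*ˡ μ [ 0 ≡ a ]ℤ _)) ⟩
  sgn δ *ℤ β δ (a + suc μ) +ℤ [ 0 ≡ a ]ℤ *ℤ conv μ (λ k l → sgn (suc d + k) *ℤ β (suc d + k) l)
    ≡⟨ cong (λ z → sgn δ *ℤ β δ (a + suc μ) +ℤ [ 0 ≡ a ]ℤ *ℤ z) tail ⟩
  sgn δ *ℤ β δ (a + suc μ) +ℤ [ 0 ≡ a ]ℤ *ℤ (- (sgn d *ℤ β d μ))
    ≡⟨ finish a ⟩
  uniformPoly μ δ a ∎
  where
  d = δ + a
  ψ : ℕ → ℤ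
  ψ s = if (d ∸ s ⊓ d) ≡ᵇ a then sgn s else + 0

  rearrange : ∀ b c s → b *ℤ (c *ℤ s) ≡ c *ℤ (s *ℤ b)
  rearrange = solve-∀

  low : ∀ s e → s + e ≡ d → β s (e + suc μ) *ℤ ψ s ≡ [ e ≡ a ]ℤ *ℤ (sgn s *ℤ β s (e + suc μ))
  low s e s+e≡d = begin
    β s (e + suc μ) *ℤ ψ s
      ≡⟨ cong (β s (e + suc μ) *ℤ_) (trans (cong (λ j → if j ≡ᵇ a then sgn s else + 0) d∸s≡e) (if-scale (e ≡ᵇ a) (sgn s))) ⟩
    β s (e + suc μ) *ℤ ([ e ≡ a ]ℤ *ℤ sgn s)
      ≡⟨ rearrange (β s (e + suc μ)) [ e ≡ a ]ℤ (sgn s) ⟩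
    [ e ≡ a ]ℤ *ℤ (sgn s *ℤ β s (e + suc μ)) ∎
    where
    d∸s≡e : d ∸ s ⊓ d ≡ e
    d∸s≡e = begin
      d ∸ s ⊓ d    ≡⟨ cong (d ∸_) (ℕP.m≤n⇒m⊓n≡m (subst (s ≤_) s+e≡d (ℕP.m≤m+n s e))) ⟩
      d ∸ s        ≡⟨ cong (_∸ s) s+e≡d ⟨
      s + e ∸ s    ≡⟨ ℕP.m+n∸m≡n s e ⟩
      e ∎

  high : ∀ k l → β (suc d + k) l *ℤ ψ (suc d + k) ≡ [ 0 ≡ a ]ℤ *ℤ (sgn (suc d + k) *ℤ β (suc d + k) l)
  high k l = begin
    β (suc d + k) l *ℤ ψ (suc d + k)
      ≡⟨ cong (β (suc d + k) l *ℤ_) (trans (cong (λ j → if j ≡ᵇ a then sgn (suc d + k) else + 0) d∸d≡0) (if-scale (0 ≡ᵇ a) (sgn (suc d + k)))) ⟩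
    β (suc d + k) l *ℤ ([ 0 ≡ a ]ℤ *ℤ sgn (suc d + k))
      ≡⟨ rearrange (β (suc d + k) l) [ 0 ≡ a ]ℤ (sgn (suc d + k)) ⟩
    [ 0 ≡ a ]ℤ *ℤ (sgn (suc d + k) *ℤ β (suc d + k) l) ∎
    where
    d∸d≡0 : d ∸ (suc d + k) ⊓ d ≡ 0
    d∸d≡0 = trans (cong (d ∸_) (ℕP.m≥n⇒m⊓n≡n (ℕP.≤-trans (ℕP.n≤1+n d) (ℕP.m≤m+n (suc d) k)))) (ℕP.n∸n≡0 d)

  -- The alternating sum over all sizes vanishes, so the sizes above d contribute minus the partial
  -- sum over sizes up to d.
  tail : conv μ (λ k l → sgn (suc d + k) *ℤ β (suc d + k) l) ≡ - (sgn d *ℤ β d μ)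
  tail = ℤG.inverseʳ-unique (sgn d *ℤ β d μ) _ (begin
    sgn d *ℤ β d μ +ℤ conv μ (λ k l → sgn (suc d + k) *ℤ β (suc d + k) l)
      ≡⟨ cong (_+ℤ conv μ (λ k l → sgn (suc d + k) *ℤ β (suc d + k) l)) (alternating-partial-sum d μ) ⟨
    conv d (λ s e → sgn s *ℤ β s (e + suc μ)) +ℤ conv μ (λ k l → sgn (suc d + k) *ℤ β (suc d + k) l)
      ≡⟨ conv-split d μ (λ k l → sgn k *ℤ β k l) ⟨
    conv (d + suc μ) (λ k l → sgn k *ℤ β k l)
      ≡⟨ cong (λ n → conv n (λ k l → sgn k *ℤ β k l)) (ℕP.+-suc d μ) ⟩
    conv (suc (d + μ)) (λ k l → sgn k *ℤ β k l)
      ≡⟨ alternating-sum (suc (d + μ)) ⟩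
    + 0 ∎)

  finish : ∀ a → sgn δ *ℤ β δ (a + suc μ) +ℤ [ 0 ≡ a ]ℤ *ℤ (- (sgn (δ + a) *ℤ β (δ + a) μ)) ≡ uniformPoly μ δ a
  finish zero    = trans
    (cong (λ n → sgn δ *ℤ β δ (suc μ) +ℤ + 1 *ℤ (- (sgn n *ℤ β n μ))) (ℕP.+-identityʳ δ))
    (factor (sgn δ) (β δ (suc μ)) (β δ μ))
    where
    factor : ∀ s x y → s *ℤ x +ℤ + 1 *ℤ (- (s *ℤ y)) ≡ s *ℤ (x - + 1 *ℤ y)
    factor = solve-∀
  finish (suc a) = factor (sgn δ) (β δ (suc a + suc μ)) (sgn (δ + suc a) *ℤ β (δ + suc a) μ) (β δ μ)
    where
    factor : ∀ s x y z → s *ℤ x +ℤ + 0 *ℤ (- y) ≡ s *ℤ (x - + 0 *ℤ z)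
    factor = solve-∀

charPoly-uniform : ∀ {μ n} {M : MData n} δ a → Uniform (suc μ) (δ + a) M →
  charPoly (restrict M (ground M)) a ≡ uniformPoly μ δ a
charPoly-uniform {μ} {n} {M} δ a u = begin
  sumℤ (map (λ S → if (S ⊆ᵇ G) ∧ (rk M G ∸ rk M S ≡ᵇ a) then sgn (size S) else + 0) (subsets n))
    ≡⟨ cong sumℤ (map-cong (λ S → if-∧ (S ⊆ᵇ G)) (subsets n)) ⟩
  sumℤ (map (λ S → if S ⊆ᵇ G then (if rk M G ∸ rk M S ≡ᵇ a then sgn (size S) else + 0) else + 0) (subsets n))
    ≡⟨ sum-over-subsets G (λ S → if rk M G ∸ rk M S ≡ᵇ a then sgn (size S) else + 0) (λ s _ → ψ s)
         (λ S S⊆G _ _ → cong (λ j → if j ≡ᵇ a then sgn (size S) else + 0)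
            (cong₂ _∸_ (rank≡d u) (rk-⊆ u S (⊆ᵇ-sound S G S⊆G)))) ⟩
  conv (size G) (λ s s′ → β s s′ *ℤ ψ s)
    ≡⟨ cong (λ k → conv k (λ s s′ → β s s′ *ℤ ψ s)) (card u) ⟩
  conv (δ + a + suc μ) (λ s s′ → β s s′ *ℤ ψ s)
    ≡⟨ uniformPoly-sum μ δ a ⟩
  uniformPoly μ δ a ∎
  where
  G = ground M
  ψ : ℕ → ℤ
  ψ s = if (δ + a ∸ s ⊓ (δ + a)) ≡ᵇ a then sgn s else + 0

*P-cong : ∀ {p p′ q q′ : Poly} → (∀ k → p k ≡ p′ k) → (∀ k → q k ≡ q′ k) → ∀ a → (p *P q) a ≡ (p′ *P q′) a
*P-cong {p} {p′} {q} {q′} p≡p′ q≡q′ a = begin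
  (p *P q) a                          ≡⟨ *P-conv p q a ⟩
  conv a (λ k l → p k *ℤ q l)         ≡⟨ conv-cong a (λ k l _ → cong₂ _*ℤ_ (p≡p′ k) (q≡q′ l)) ⟩
  conv a (λ k l → p′ k *ℤ q′ l)       ≡⟨ *P-conv p′ q′ a ⟨
  (p′ *P q′) a ∎

*P-oneP : ∀ p a → (p *P oneP) a ≡ p a
*P-oneP p a = begin
  (p *P oneP) a                                ≡⟨ *P-conv p oneP a ⟩
  conv a (λ k l → p k *ℤ oneP l)               ≡⟨ conv-cong a (λ k l _ → trans (ℤP.*-comm (p k) (oneP l)) (cong (_*ℤ p k) (oneP≡ l))) ⟩
  conv a (λ k l → [ l ≡ 0 ]ℤ *ℤ p k)           ≡⟨ cong (λ n → conv n (λ k l → [ l ≡ 0 ]ℤ *ℤ p k)) (ℕP.+-identityʳ a) ⟨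
  conv (a + 0) (λ k l → [ l ≡ 0 ]ℤ *ℤ p k)     ≡⟨ conv-selectʳ a 0 (λ k _ → p k) ⟩
  p a ∎
  where
  oneP≡ : ∀ l → oneP l ≡ [ l ≡ 0 ]ℤ
  oneP≡ zero    = refl
  oneP≡ (suc l) = refl

boolPoly-0-*P : ∀ q a → (boolPoly 0 *P q) a ≡ q a
boolPoly-0-*P q a = begin
  (boolPoly 0 *P q) a                          ≡⟨ *P-conv (boolPoly 0) q a ⟩
  conv a (λ k l → boolPoly 0 k *ℤ q l)         ≡⟨ conv-cong a (λ k l _ → cong (_*ℤ q l) (boolPoly-0 k)) ⟩
  conv a (λ k l → [ k ≡ 0 ]ℤ *ℤ q l)           ≡⟨ conv-selectˡ 0 a (λ _ l → q l) ⟩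
  q a ∎
  where
  boolPoly-0 : ∀ k → boolPoly 0 k ≡ [ k ≡ 0 ]ℤ
  boolPoly-0 zero    = refl
  boolPoly-0 (suc k) = refl

-- Kazhdan-Lusztig polynomials of uniform matroids

module KazhdanLusztig (P : {n : ℕ} → MData n → Poly) (kl : IsKL P) (μ : ℕ) where

  -- The contribution to KLsum of a subset with j elements and j′ elements in its complement: it is a
  -- flat only if j′ = 0 (the ground set) or j′ > suc μ (an independent set of corank j′ ∸ suc μ).
  flatTerm : ℤ → (ℕ → ℕ → ℤ) → ℕ → ℕ → ℤ
  flatTerm X ψ j zero    = X
  flatTerm X ψ j (suc j′) = if μ <ᵇ j′ then ψ j (j′ ∸ μ) else + 0

  <ᵇ-true : ∀ {a b} → a < b → (a <ᵇ b) ≡ true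
  <ᵇ-true a<b = Equivalence.to T-≡ (ℕP.<⇒<ᵇ a<b)

  <ᵇ-false : ∀ {a b} → b ≤ a → (a <ᵇ b) ≡ false
  <ᵇ-false z≤n     = refl
  <ᵇ-false (s≤s p) = <ᵇ-false p

  -- Above size d only the ground set survives. Sets of size exactly d are not flats, which the
  -- condition `ψ j 0 ≡ + 0` matches at e = 0.
  sum-flatTerms : ∀ d X ψ → (∀ j → ψ j 0 ≡ + 0) →
    conv (d + suc μ) (λ j j′ → β j j′ *ℤ flatTerm X ψ j j′) ≡ X +ℤ conv d (λ j e → β j (e + suc μ) *ℤ ψ j e)
  sum-flatTerms d X ψ ψ0 = begin
    conv (d + suc μ) (λ j j′ → β j j′ *ℤ flatTerm X ψ j j′)
      ≡⟨ conv-split d μ (λ j j′ → β j j′ *ℤ flatTerm X ψ j j′) ⟩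
    conv d (λ j e → β j (e + suc μ) *ℤ flatTerm X ψ j (e + suc μ)) +ℤ
    conv μ (λ k l → β (suc d + k) l *ℤ flatTerm X ψ (suc d + k) l)
      ≡⟨ cong₂ _+ℤ_ (conv-cong d (λ j e _ → cong (β j (e + suc μ) *ℤ_) (small j e)))
           (trans (conv-cong μ large) (trans (cong (λ n → conv n F) (sym (ℕP.+-identityʳ μ)))
             (conv-selectʳ μ 0 (λ k l → β (suc d + k) l *ℤ X)))) ⟩
    conv d (λ j e → β j (e + suc μ) *ℤ ψ j e) +ℤ β (suc d + μ) 0 *ℤ X
      ≡⟨ ℤP.+-comm (conv d (λ j e → β j (e + suc μ) *ℤ ψ j e)) _ ⟩
    β (suc d + μ) 0 *ℤ X +ℤ conv d (λ j e → β j (e + suc μ) *ℤ ψ j e)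
      ≡⟨ cong (_+ℤ conv d (λ j e → β j (e + suc μ) *ℤ ψ j e)) (trans (cong (_*ℤ X) (β-0ʳ (suc d + μ))) (ℤP.*-identityˡ X)) ⟩
    X +ℤ conv d (λ j e → β j (e + suc μ) *ℤ ψ j e) ∎
    where
    F : ℕ → ℕ → ℤ
    F k l = [ l ≡ 0 ]ℤ *ℤ (β (suc d + k) l *ℤ X)

    small : ∀ j e → flatTerm X ψ j (e + suc μ) ≡ ψ j e
    small j zero    = trans (cong (λ b → if b then ψ j (μ ∸ μ) else + 0) (<ᵇ-false {μ} {μ} ℕP.≤-refl)) (sym (ψ0 j))
    small j (suc e) = begin
      (if μ <ᵇ (e + suc μ) then ψ j (e + suc μ ∸ μ) else + 0)
        ≡⟨ cong (λ b → if b then ψ j (e + suc μ ∸ μ) else + 0) (<ᵇ-true (ℕP.m≤n+m (suc μ) e)) ⟩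
      ψ j (e + suc μ ∸ μ)
        ≡⟨ cong (ψ j) (trans (cong (_∸ μ) (ℕP.+-suc e μ)) (ℕP.m+n∸n≡m (suc e) μ)) ⟩
      ψ j (suc e) ∎

    large : ∀ k l → k + l ≡ μ → β (suc d + k) l *ℤ flatTerm X ψ (suc d + k) l ≡ F k l
    large k zero    _   = sym (ℤP.*-identityˡ _)
    large k (suc l) k+l≡μ = begin
      β (suc d + k) (suc l) *ℤ flatTerm X ψ (suc d + k) (suc l)
        ≡⟨ cong (λ b → β (suc d + k) (suc l) *ℤ (if b then ψ (suc d + k) (l ∸ μ) else + 0))
             (<ᵇ-false (ℕP.≤-trans (ℕP.n≤1+n l) (subst (suc l ≤_) k+l≡μ (ℕP.m≤n+m (suc l) k)))) ⟩
      β (suc d + k) (suc l) *ℤ + 0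
        ≡⟨ ℤP.*-zeroʳ (β (suc d + k) (suc l)) ⟩
      + 0 ∎

  -- The ground set contributes its characteristic polynomial, since its contraction has polynomial
  -- 1. The contribution of smaller flats is an assumption, because `rank-step` knows the
  -- polynomials of contractions only inductively.
  KLsum-uniform : ∀ {n} {M : MData n} δ a → Uniform (suc μ) (δ + a) M →
    (ψ : ℕ → ℕ → ℤ) → (∀ j → ψ j 0 ≡ + 0) →
    (∀ F → F ⊆ᵇ ground M ≡ true → ∀ e → size F + suc e ≡ δ + a →
      (charPoly (restrict M F) *P P (contract M F)) a ≡ ψ (size F) (suc e)) →
    KLsum P M a ≡ uniformPoly μ δ a +ℤ conv (δ + a) (λ j e → β j (e + suc μ) *ℤ ψ j e)
  KLsum-uniform {n} {M} δ a u ψ ψ0 smallFlat = begin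
    sumℤ (map (λ F → if (F ⊆ᵇ G) ∧ closed M F then term F else + 0) (subsets n))
      ≡⟨ cong sumℤ (map-cong (λ F → if-∧ (F ⊆ᵇ G)) (subsets n)) ⟩
    sumℤ (map (λ F → if F ⊆ᵇ G then (if closed M F then term F else + 0) else + 0) (subsets n))
      ≡⟨ sum-over-subsets G (λ F → if closed M F then term F else + 0) (flatTerm X ψ) classify ⟩
    conv (size G) (λ j j′ → β j j′ *ℤ flatTerm X ψ j j′)
      ≡⟨ cong (λ k → conv k (λ j j′ → β j j′ *ℤ flatTerm X ψ j j′)) (card u) ⟩
    conv (d + suc μ) (λ j j′ → β j j′ *ℤ flatTerm X ψ j j′)
      ≡⟨ sum-flatTerms d X ψ ψ0 ⟩
    X +ℤ conv d (λ j e → β j (e + suc μ) *ℤ ψ j e)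
      ≡⟨ cong (_+ℤ conv d (λ j e → β j (e + suc μ) *ℤ ψ j e)) (charPoly-uniform δ a u) ⟩
    uniformPoly μ δ a +ℤ conv d (λ j e → β j (e + suc μ) *ℤ ψ j e) ∎
    where
    d = δ + a
    G = ground M
    X = charPoly (restrict M G) a
    term : Subset n → ℤ
    term F = (charPoly (restrict M F) *P P (contract M F)) a

    term-ground : term G ≡ X
    term-ground = trans
      (*P-cong {charPoly (restrict M G)} (λ _ → refl)
        (proj₁ (kl (contract M G) (contract-ground-loopless M)) (contract-ground-rank M)) a)
      (*P-oneP (charPoly (restrict M G)) a)

    classify : ∀ F → F ⊆ᵇ G ≡ true → ∀ j′ → size F + j′ ≡ size G →
      (if closed M F then term F else + 0) ≡ flatTerm X ψ (size F) j′
    classify F F⊆G zero eq with ⊆∧∣≡∣⇒≡ F G F⊆G (trans (sym (ℕP.+-identityʳ (size F))) eq)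
    ... | refl = trans (cong (λ b → if b then term G else + 0) (closed-ground M)) term-ground
    classify F F⊆G (suc j′) eq with ℕP.<-≤-connex μ j′
    ... | inj₁ μ<j′ = begin
      (if closed M F then term F else + 0)
        ≡⟨ cong (λ b → if b then term F else + 0) (closed-small u F F⊆G F<d) ⟩
      term F
        ≡⟨ smallFlat F F⊆G e F+e≡d ⟩
      ψ (size F) (suc e)
        ≡⟨ cong (ψ (size F)) j′∸μ≡e ⟨
      ψ (size F) (j′ ∸ μ)
        ≡⟨ cong (λ b → if b then ψ (size F) (j′ ∸ μ) else + 0) (<ᵇ-true μ<j′) ⟨
      flatTerm X ψ (size F) (suc j′) ∎
      where
      -- With j′ + 1 elements outside `F` and m = μ + 1, the corank of `F` is j′ - μ = e + 1.
      e = j′ ∸ suc μ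
      j′≡ : e + suc μ ≡ j′
      j′≡ = ℕP.m∸n+n≡m μ<j′
      j′∸μ≡e : j′ ∸ μ ≡ suc e
      j′∸μ≡e = trans (cong (_∸ μ) (trans (sym j′≡) (ℕP.+-suc e μ))) (ℕP.m+n∸n≡m (suc e) μ)
      F+e≡d : size F + suc e ≡ d
      F+e≡d = ℕP.+-cancelʳ-≡ (suc μ) _ _ (begin
        size F + suc e + suc μ      ≡⟨ ℕP.+-assoc (size F) (suc e) (suc μ) ⟩
        size F + suc (e + suc μ)    ≡⟨ cong (λ k → size F + suc k) j′≡ ⟩
        size F + suc j′             ≡⟨ trans eq (card u) ⟩
        d + suc μ ∎)
      F<d : size F < d
      F<d = subst (size F <_) F+e≡d (ℕP.m<m+n (size F) (s≤s z≤n))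
    ... | inj₂ j′≤μ = begin
      (if closed M F then term F else + 0)
        ≡⟨ cong (λ b → if b then term F else + 0) (closed-large u F F⊆G d≤F F<G) ⟩
      + 0
        ≡⟨ cong (λ b → if b then ψ (size F) (j′ ∸ μ) else + 0) (<ᵇ-false j′≤μ) ⟨
      flatTerm X ψ (size F) (suc j′) ∎
      where
      F<G : size F < size G
      F<G = subst (size F <_) eq (ℕP.m<m+n (size F) (s≤s z≤n))
      d≤F : d ≤ size F
      d≤F = ℕP.+-cancelʳ-≤ (suc μ) d (size F)
        (ℕP.≤-trans (ℕP.≤-reflexive (sym (trans eq (card u)))) (ℕP.+-monoʳ-≤ (size F) (s≤s j′≤μ)))

  degree-bound : ∀ {n d} {M : MData n} → 0 < d → Uniform (suc μ) d M → ∀ i → d ≤ i + i → P M i ≡ + 0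
  degree-bound {d = d} {M} 0<d u i d≤2i =
    proj₁ (proj₂ (kl M (uniform⇒loopless 0<d u))) (subst (0 <_) (sym (rank≡d u)) 0<d) i
      (ℕP.≤-trans (ℕP.≤-reflexive (rank≡d u)) (ℕP.≤-trans d≤2i (ℕP.≤-reflexive (cong (λ k → i + k) (sym (ℕP.+-identityʳ i))))))

  -- Reversal in degree δ + a exchanges the coefficients of t^δ and t^a.
  coefficient : ∀ {n} {M : MData n} δ a → 0 < δ + a → Uniform (suc μ) (δ + a) M → P M δ ≡ KLsum P M a
  coefficient {M = M} δ a 0<d u = begin
    P M δ
      ≡⟨ cong (P M) (ℕP.m+n∸n≡m δ a) ⟨
    P M (δ + a ∸ a)
      ≡⟨ cong (λ b → if b then P M (δ + a ∸ a) else + 0) (Equivalence.to T-≡ (ℕP.≤⇒≤ᵇ (ℕP.m≤n+m a δ))) ⟨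
    reflect (δ + a) (P M) a
      ≡⟨ cong (λ r → reflect r (P M) a) (rank≡d u) ⟨
    reflect (rank M) (P M) a
      ≡⟨ proj₂ (proj₂ (kl M (uniform⇒loopless 0<d u))) a ⟩
    KLsum P M a ∎

  Q : ℕ → Poly
  -- The value 0 instead of the rank-zero polynomial 1 discards the sets of size d, which are not
  -- flats; the ground set is counted by `uniformPoly`.
  Q zero    i = + 0
  Q (suc d) i = P (U (suc μ) (suc d)) i

  Q-degree : ∀ d i → d ≤ i + i → Q d i ≡ + 0
  Q-degree zero    i _    = refl
  Q-degree (suc d) i d≤2i = degree-bound (s≤s z≤n) (U-uniform (suc μ) (suc d)) i d≤2i

  *P-Q0 : ∀ j a → (boolPoly j *P Q 0) a ≡ + 0
  *P-Q0 j a = trans (*P-conv (boolPoly j) (Q 0) a) (conv-0 a (λ k l _ → ℤP.*-zeroʳ (boolPoly j k)))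

  size≤d : ∀ {j e d} → j + suc e ≡ d → j ≤ d
  size≤d {j} {e} eq = subst (j ≤_) eq (ℕP.m≤m+n j (suc e))

  -- `IsKL` does not state invariance under relabelling, so the agreement of `P` on a contraction
  -- with its value on the model `U` has to be derived from the recursion.
  DependsOnlyOnRank : ℕ → Set
  DependsOnlyOnRank d = 0 < d → ∀ {n} {M : MData n} → Uniform (suc μ) d M → ∀ i → P M i ≡ Q d i

  -- Reading the recursion in degree d - i > d / 2 leaves no contribution of the empty flat, whose
  -- contraction is the only one of full rank d.
  rank-step : ∀ d → (∀ {d′} → d′ < d → DependsOnlyOnRank d′) → DependsOnlyOnRank d
  rank-step zero    rec ()
  rank-step d@(suc d-1) rec 0<d {n} {M} u i with ℕP.≤-<-connex d (i + i)
  ... | inj₁ d≤2i = trans (degree-bound 0<d u i d≤2i) (sym (Q-degree d i d≤2i))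
  -- The right-hand side of `expand` does not mention `M`, so it serves both for `M` and for the
  -- model.
  ... | inj₂ 2i<d = trans (expand u) (sym (expand (U-uniform (suc μ) d)))
    where
    a = d ∸ i
    i≤d : i ≤ d
    i≤d = ℕP.≤-trans (ℕP.m≤m+n i i) (ℕP.<⇒≤ 2i<d)
    i+a≡d : i + a ≡ d
    i+a≡d = ℕP.m+[n∸m]≡n i≤d
    d≤2a : d ≤ a + a
    d≤2a = subst (_≤ a + a) i+a≡d (ℕP.+-monoˡ-≤ a (ℕP.+-cancelˡ-≤ i i a
      (ℕP.≤-trans (ℕP.<⇒≤ 2i<d) (ℕP.≤-reflexive (sym i+a≡d)))))

    expand : ∀ {n} {M : MData n} → Uniform (suc μ) d M →
      P M i ≡ uniformPoly μ i a +ℤ conv (i + a) (λ j e → β j (e + suc μ) *ℤ (boolPoly j *P Q e) a)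
    expand {M = M} u = trans (coefficient i a 0<i+a u′)
      (KLsum-uniform i a u′ (λ j e → (boolPoly j *P Q e) a) (λ j → *P-Q0 j a) flat)
      where
      0<i+a : 0 < i + a
      0<i+a = subst (0 <_) (sym i+a≡d) 0<d
      u′ : Uniform (suc μ) (i + a) M
      u′ = subst (λ k → Uniform (suc μ) k M) (sym i+a≡d) u
      flat : ∀ F → F ⊆ᵇ ground M ≡ true → ∀ e → size F + suc e ≡ i + a →
        (charPoly (restrict M F) *P P (contract M F)) a ≡ (boolPoly (size F) *P Q (suc e)) a
      flat F F⊆G e eq = trans
        (*P-cong {q = P (contract M F)} (charPoly-small u F F⊆G (size≤d eq′)) (λ _ → refl) a)
        (tail (size F) eq′)
        where
        eq′ : size F + suc e ≡ d
        eq′ = trans eq i+a≡d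
        u/F : Uniform (suc μ) (suc e) (contract M F)
        u/F = contract-uniform u F F⊆G (suc e) eq′
        tail : ∀ j → j + suc e ≡ d → (boolPoly j *P P (contract M F)) a ≡ (boolPoly j *P Q (suc e)) a
        tail zero    e≡d = begin
          (boolPoly 0 *P P (contract M F)) a    ≡⟨ boolPoly-0-*P (P (contract M F)) a ⟩
          P (contract M F) a                    ≡⟨ degree-bound (s≤s z≤n) u/F a (subst (_≤ a + a) (sym e≡d) d≤2a) ⟩
          + 0                                   ≡⟨ Q-degree (suc e) a (subst (_≤ a + a) (sym e≡d) d≤2a) ⟨
          Q (suc e) a                           ≡⟨ boolPoly-0-*P (Q (suc e)) a ⟨
          (boolPoly 0 *P Q (suc e)) a ∎
        tail (suc j) j+e≡d = *P-cong {boolPoly (suc j)} (λ _ → refl)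
          (rec (subst (suc e <_) j+e≡d (s≤s (ℕP.m≤n+m (suc e) j))) (s≤s z≤n) u/F) a

  P-uniform : ∀ d → DependsOnlyOnRank d
  P-uniform = <-rec DependsOnlyOnRank rank-step

  Q-recursion : ∀ δ a → 0 < δ → Q (δ + a) δ ≡
    uniformPoly μ δ a +ℤ conv (δ + a) (λ j e → β j (e + suc μ) *ℤ (boolPoly j *P Q e) a)
  Q-recursion (suc δ-1) a 0<δ = trans (coefficient δ a (s≤s z≤n) u)
    (KLsum-uniform δ a u (λ j e → (boolPoly j *P Q e) a) (λ j → *P-Q0 j a)
      (λ F F⊆G e eq → *P-cong (charPoly-small u F F⊆G (size≤d eq))
        (P-uniform (suc e) (s≤s z≤n) (contract-uniform u F F⊆G (suc e) eq)) a))
    where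
    δ = suc δ-1
    u = U-uniform (suc μ) (δ + a)

-- The formula with integer binomial tops

binomℤ-summand : ∀ D i h → + ((D + h) C (h + i + 1)) *ℤ binomℤ ((+ i +ℤ + h) - + 1) h ≡ summand D i h
binomℤ-summand D i h = cong (+ ((D + h) C (h + i + 1)) *ℤ_) (reduce i h)
  where
  reduce : ∀ i h → binomℤ ((+ i +ℤ + h) - + 1) h ≡ + ((i + h ∸ 1) C h)
  -- The only case with a negative top: C(-1, 0) = 1.
  reduce zero    zero    = refl
  reduce zero    (suc h) = refl
  reduce (suc i) h       = refl

theorem1p4 : (P : {n : ℕ} → MData n → Poly) → IsKL P →
    (m d : ℕ) → 1 ≤ m → 1 ≤ d →
    (i : ℕ) → 2 * i ≤ d ∸ 1 →
    (+ (d ∸ i)) *ℤ P (U m d) i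
    ≡ (+ ((d + m) C i)) *ℤ
    Σ< m (λ h → (+ ((d ∸ i + h) C (h + i + 1))) *ℤ binomℤ ((+ i +ℤ + h) - + 1) h)
theorem1p4 P kl (suc μ) d@(suc d-1) _ _ i 2i≤d-1 = begin
  + (d ∸ i) *ℤ P (U (suc μ) d) i
    ≡⟨ cong₂ (λ x y → + x *ℤ Q y i) d∸i≡D d≡ ⟩
  + (suc r + i) *ℤ Q (r + suc (i + i)) i
    ≡⟨ Q-formula r i ⟩
  β i (r + suc i + suc μ) *ℤ Σ< (suc μ) (summand (suc r + i) i)
    ≡⟨ cong₂ _*ℤ_ (cong (λ n → + (n C i)) d+m≡)
         (Σ<-cong (suc μ) (λ h → trans (cong (λ D → summand D i h) (sym d∸i≡D)) (sym (binomℤ-summand (d ∸ i) i h)))) ⟩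
  + ((d + suc μ) C i) *ℤ Σ< (suc μ) (λ h → (+ ((d ∸ i + h) C (h + i + 1))) *ℤ binomℤ ((+ i +ℤ + h) - + 1) h) ∎
  where
  open KazhdanLusztig P kl μ using (Q; Q-degree; Q-recursion)
  open Recursion μ Q Q-degree Q-recursion using (Q-formula)
  -- Writing d = r + 2i + 1 expresses the bound on i without subtraction, and d - i becomes r + 1 +
  -- i.
  r = d-1 ∸ (i + i)
  2i≤ : i + i ≤ d-1
  2i≤ = subst (_≤ d-1) (cong (λ k → i + k) (ℕP.+-identityʳ i)) 2i≤d-1
  d≡ : d ≡ r + suc (i + i)
  d≡ = sym (trans (ℕP.+-suc r (i + i)) (cong suc (ℕP.m∸n+n≡m 2i≤)))
  d∸i≡D : d ∸ i ≡ suc r + i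
  d∸i≡D = trans (cong (_∸ i) (trans d≡ (split r i))) (ℕP.m+n∸n≡m (suc r + i) i)
    where
    split : ∀ r i → r + suc (i + i) ≡ suc r + i + i
    split = ℕSolver.solve-∀
  d+m≡ : i + (r + suc i + suc μ) ≡ d + suc μ
  d+m≡ = trans (reassoc i r (suc μ)) (cong (_+ suc μ) (sym d≡))
    where
    reassoc : ∀ i r m → i + (r + suc i + m) ≡ r + suc (i + i) + m
    reassoc = ℕSolver.solve-∀
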